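{- Let $k,d\geq 2$ be integers, and let $T_{k+1}(d)$ be the symmetric tree of diameter $d$ whose non-leaf vertices all have degree $k+1$. If $d$ is even, then $$hc(T_{k+1}(d))=\frac{(k+1)^2}{(k-1)^2}\left(k^{\frac d2}-1\right)\left[\left(k^{\frac d2}-1\right)+\frac{1}{k+1}\bigl(2-(k-1)d\bigr)\right]-\frac{k+1}{k-1}d+1,$$ and if $d$ is odd, then $$hc(T_{k+1}(d))=\frac{4k}{(k-1)^2}\left(k^{\frac{d-1}{2}}-1\right)\left[k\left(k^{\frac{d-1}{2}}-1\right)+1\right]+\frac{2k}{k-1}(2-d)k^{\frac{d-1}{2}}-\frac{2k}{k-1}.$$
   Context: For a connected graph $G$ of order $n$ (finite, simple), $D(u,v)$ denotes the detour distance between vertices $u,v$, i.e. the length of a longest $u,v$-path in $G$ (for a tree this is the ordinary distance). A hamiltonian coloring of $G$ is a map $c: V(G)\to\{0,1,2,\dots\}$ such that $D(u,v)+|c(u)-c(v)|\geq n-1$ for every two distinct vertices $u,v$. The value $hc(c)$ is the maximum color assigned by $c$, and the hamiltonian chromatic number $hc(G)$ is the minimum of $hc(c)$ over all hamiltonian colorings $c$ of $G$ (note that the color $0$ is allowed). A symmetric tree is a tree in which all vertices other than leaves (degree-one vertices) have the same degree and all leaves have the same eccentricity. $T_{k+1}(d)$ denotes the symmetric tree with diameter $d$ and non-leaf vertices of degree $k+1$. -}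

module Defs where

open import Data.Fin.Base using (Fin)
open import Data.Integer.Base using (+_)
open import Data.List.Base using (List; []; _∷_; length; filter; allFin)
open import Data.List.Relation.Unary.Unique.Propositional using (Unique)
open import Data.Nat.Base as ℕ
  using (ℕ; zero; suc; _≤_; _∸_; _^_; ∣_-_∣; NonZero; NonTrivial; nonTrivial⇒n>1; >-nonZero)
open import Data.Nat.Properties using (m<n⇒0<n∸m; m^n≢0)
open import Data.Product.Base using (∃-syntax; _×_)
open import Data.Rational.Base using (ℚ; 1ℚ; _+_; _-_; _*_; _/_)
open import Level using (0ℓ)
open import Relation.Binary.Construct.Closure.ReflexiveTransitive using (Star; ε; _◅_)
open import Relation.Binary.Core using (Rel)
open import Relation.Binary.Definitions using (Decidable; Irreflexive; Symmetric)
open import Relation.Binary.PropositionalEquality using (_≡_; _≢_)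
open import Relation.Nullary.Negation using (¬_)

IsLeast : (ℕ → Set) → ℕ → Set
IsLeast P m = P m × (∀ x → P x → m ≤ x)

IsGreatest : (ℕ → Set) → ℕ → Set
IsGreatest P m = P m × (∀ x → P x → x ≤ m)

record Graph (n : ℕ) : Set₁ where
  field
    Adj        : Rel (Fin n) 0ℓ
    adj?       : Decidable Adj
    adj-irrefl : Irreflexive _≡_ Adj
    adj-sym    : Symmetric Adj

module _ {n : ℕ} (G : Graph n) where
  open Graph G

  Walk : Rel (Fin n) 0ℓ
  Walk = Star Adj

  edges : ∀ {u v} → Walk u v → ℕ
  edges ε       = 0
  edges (_ ◅ w) = suc (edges w)

  support : ∀ {u v} → Walk u v → List (Fin n)
  support {u} ε       = u ∷ []
  support {u} (_ ◅ w) = u ∷ support w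

  IsPath : ∀ {u v} → Walk u v → Set
  IsPath w = Unique (support w)

  degree : Fin n → ℕ
  degree v = length (filter (adj? v) (allFin n))

  record Connected : Set where
    field
      nonempty : NonZero n
      walk     : ∀ u v → Walk u v

  -- A cycle is a path with at least two edges whose ends are adjacent.
  Acyclic : Set
  Acyclic = ∀ {u v} (w : Walk u v) → IsPath w → 2 ≤ edges w → ¬ Adj v u

  record IsTree : Set where
    field
      connected : Connected
      acyclic   : Acyclic

  IsDistance : Fin n → Fin n → ℕ → Set
  IsDistance u v = IsLeast (λ ℓ → ∃[ w ] edges {u} {v} w ≡ ℓ)

  IsDetourDistance : Fin n → Fin n → ℕ → Set
  IsDetourDistance u v = IsGreatest (λ ℓ → ∃[ w ] IsPath {u} {v} w × edges w ≡ ℓ)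

  IsEccentricity : Fin n → ℕ → Set
  IsEccentricity u = IsGreatest (λ ℓ → ∃[ v ] IsDistance u v ℓ)

  IsDiameter : ℕ → Set
  IsDiameter = IsGreatest (λ e → ∃[ u ] IsEccentricity u e)

  IsLeaf : Fin n → Set
  IsLeaf v = degree v ≡ 1

  record IsSymmetricTree : Set where
    field
      isTree            : IsTree
      nonleaf-degree    : ∀ u v → ¬ IsLeaf u → ¬ IsLeaf v → degree u ≡ degree v
      leaf-eccentricity : ∀ u v → IsLeaf u → IsLeaf v →
                          ∀ e f → IsEccentricity u e → IsEccentricity v f → e ≡ f

  -- The graph is a copy of T_r(d).
  record IsT (r d : ℕ) : Set where
    field
      isSymmetricTree : IsSymmetricTree
      nonleaf-degree  : ∀ v → ¬ IsLeaf v → degree v ≡ r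
      diameter        : IsDiameter d

  IsHamiltonianColoring : (Fin n → ℕ) → Set
  IsHamiltonianColoring c =
    ∀ u v → u ≢ v → ∀ D → IsDetourDistance u v D → n ∸ 1 ≤ D ℕ.+ ∣ c u - c v ∣

  IsMaxColor : (Fin n → ℕ) → ℕ → Set
  IsMaxColor c = IsGreatest (λ m → ∃[ v ] c v ≡ m)

  IsHamiltonianChromaticNumber : ℕ → Set
  IsHamiltonianChromaticNumber =
    IsLeast (λ m → ∃[ c ] IsHamiltonianColoring c × IsMaxColor c m)

fromℕ : ℕ → ℚ
fromℕ m = + m / 1

module _ (k d : ℕ) .{{_ : NonTrivial k}} where
  private
    instance
      k-1≢0 : NonZero (k ∸ 1)
      k-1≢0 = >-nonZero (m<n⇒0<n∸m (nonTrivial⇒n>1 k))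

      [k-1]²≢0 : NonZero ((k ∸ 1) ^ 2)
      [k-1]²≢0 = m^n≢0 (k ∸ 1) 2

  evenValue : ℚ
  evenValue =
    (+ (suc k ^ 2) / ((k ∸ 1) ^ 2)) * (q - 1ℚ)
      * ((q - 1ℚ) + (+ 1 / suc k) * (fromℕ 2 - fromℕ (k ∸ 1) * fromℕ d))
    - (+ suc k / (k ∸ 1)) * fromℕ d
    + 1ℚ
    where
    q : ℚ
    q = fromℕ (k ^ (d ℕ./ 2))

  oddValue : ℚ
  oddValue =
    (+ (4 ℕ.* k) / ((k ∸ 1) ^ 2)) * (q - 1ℚ) * (fromℕ k * (q - 1ℚ) + 1ℚ)
    + (+ (2 ℕ.* k) / (k ∸ 1)) * (fromℕ 2 - fromℕ d) * q
    - (+ (2 ℕ.* k) / (k ∸ 1))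
    where
    q : ℚ
    q = fromℕ (k ^ ((d ∸ 1) ℕ./ 2))

{-# OPTIONS --safe #-}
-- The detour distance D of a tree is the length of the unique path. Let f be the distance to the
-- centre of the tree (to the nearer of its two centres if d is odd) and e the number of edges of the
-- centre, so that D u v ≤ f u + f v + e, with equality iff the path from u to v runs through the
-- whole centre. Adding up the colouring condition along the vertices sorted by colour bounds the
-- largest colour from below by (n - 1)² - 2 Σ f - (n - 1) e, plus one if e = 0 since then f vanishes
-- at a single vertex. Visiting the branches at the centre in turn, one vertex at a time, makes
-- consecutive vertices lie in different branches; because 2 d ≤ n, the greedy colouring along this
-- ordering is hamiltonian, and it attains the bound.
module Submission where

open import Data.Nat.Base as ℕ using (ℕ; zero; suc; NonZero; NonTrivial)
open import Data.Nat.Divisibility using (_∣_; _∤_; divides; m%n≡0⇒n∣m)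
open import Data.Nat.Tactic.RingSolver using (solve-∀)
open import Data.Product.Base using (∃-syntax; _×_; _,_; proj₁; proj₂; map₂)
open import Relation.Binary.PropositionalEquality
  using (_≡_; _≢_; refl; sym; trans; cong; cong₂; subst; subst₂; setoid; module ≡-Reasoning)
open import Defs

-- The tree is given only through degrees and eccentricities, so its shape has to be recovered: the
-- middle of a diametral path is shown to be the centre, and the equal eccentricity of the leaves
-- forces them all to the same depth below it. Only then can vertices and depths be counted. Being a
-- path is a condition on the whole support and is awkward to transfer to joined walks. Absence of
-- backtracking is local, so it is easily checked where two walks meet, and acyclicity makes the two
-- notions agree; distances are therefore read off from reduced walks. In the lower bound Σ f is the
-- same for every ordering, so orderings differ only in f at their two ends. An optimal ordering
-- must thus make f minimal at both ends while consecutive vertices stay in different branches. This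
-- decides where the central vertices go: the centre comes last if e = 0, and the two centres come
-- first and last if e = 1. All counts are equations in ℕ without subtraction; the passage to ℚ,
-- where k - 1 can be inverted, is pure algebra.

size : ℕ → ℕ → ℕ
size k zero    = 1
size k (suc h) = suc (k ℕ.* size k h)

-- The sum of the depths in a complete k-ary tree of height h whose root has depth ℓ.
depthSum : ℕ → ℕ → ℕ → ℕ
depthSum k zero    ℓ = ℓ
depthSum k (suc h) ℓ = ℓ ℕ.+ k ℕ.* depthSum k h (suc ℓ)

-- Closed forms in ℚ for sizes, depth sums and the two values.

module ClosedForms where
  open import Data.Integer.Base as ℤ using (+_)
  import Data.Integer.Properties as ℤ
  import Data.Nat.DivMod as ℕ
  import Data.Nat.Properties as ℕ
  open import Data.Rational.Base using (ℚ; 1ℚ; _+_; _-_; _*_; _/_; toℚᵘ)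
  open import Data.Rational.Properties
  import Data.Rational.Solver as ℚ
  open import Data.Rational.Unnormalised.Base as ℚᵘ using (mkℚᵘ; *≡*; _≃_)
  import Data.Rational.Unnormalised.Properties as ℚᵘ

  toℚᵘ-/ : ∀ a b → toℚᵘ (a / suc b) ≃ mkℚᵘ a b
  toℚᵘ-/ a b = toℚᵘ-fromℚᵘ (mkℚᵘ a b)

  fromℕ-+ : ∀ a b → fromℕ (a ℕ.+ b) ≡ fromℕ a + fromℕ b
  fromℕ-+ a b = toℚᵘ-injective (begin
    toℚᵘ (fromℕ (a ℕ.+ b))             ≈⟨ toℚᵘ-/ (+ (a ℕ.+ b)) 0 ⟩
    mkℚᵘ (+ (a ℕ.+ b)) 0               ≈⟨ *≡* (cong (ℤ._* + 1)
                                            (cong₂ ℤ._+_ (sym (ℤ.*-identityʳ (+ a))) (sym (ℤ.*-identityʳ (+ b))))) ⟩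
    mkℚᵘ (+ a) 0 ℚᵘ.+ mkℚᵘ (+ b) 0     ≈⟨ ℚᵘ.+-cong (toℚᵘ-/ (+ a) 0) (toℚᵘ-/ (+ b) 0) ⟨
    toℚᵘ (fromℕ a) ℚᵘ.+ toℚᵘ (fromℕ b) ≈⟨ toℚᵘ-homo-+ (fromℕ a) (fromℕ b) ⟨
    toℚᵘ (fromℕ a + fromℕ b)           ∎)
    where open ℚᵘ.≃-Reasoning

  fromℕ-* : ∀ a b → fromℕ (a ℕ.* b) ≡ fromℕ a * fromℕ b
  fromℕ-* a b = toℚᵘ-injective (begin
    toℚᵘ (fromℕ (a ℕ.* b))             ≈⟨ toℚᵘ-/ (+ (a ℕ.* b)) 0 ⟩
    mkℚᵘ (+ (a ℕ.* b)) 0               ≈⟨ *≡* (cong (ℤ._* + 1) (ℤ.pos-* a b)) ⟩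
    mkℚᵘ (+ a) 0 ℚᵘ.* mkℚᵘ (+ b) 0     ≈⟨ ℚᵘ.*-cong (toℚᵘ-/ (+ a) 0) (toℚᵘ-/ (+ b) 0) ⟨
    toℚᵘ (fromℕ a) ℚᵘ.* toℚᵘ (fromℕ b) ≈⟨ toℚᵘ-homo-* (fromℕ a) (fromℕ b) ⟨
    toℚᵘ (fromℕ a * fromℕ b)           ∎)
    where open ℚᵘ.≃-Reasoning

  fromℕ-² : ∀ a → fromℕ (a ℕ.^ 2) ≡ fromℕ a * fromℕ a
  fromℕ-² a = trans (cong fromℕ (cong (a ℕ.*_) (ℕ.*-identityʳ a))) (fromℕ-* a a)

  /-*-fromℕ : ∀ a b .{{_ : NonZero b}} → (+ a / b) * fromℕ b ≡ fromℕ a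
  /-*-fromℕ a (suc b) = toℚᵘ-injective (begin
    toℚᵘ ((+ a / suc b) * fromℕ (suc b))            ≈⟨ toℚᵘ-homo-* (+ a / suc b) (fromℕ (suc b)) ⟩
    toℚᵘ (+ a / suc b) ℚᵘ.* toℚᵘ (fromℕ (suc b))    ≈⟨ ℚᵘ.*-cong (toℚᵘ-/ (+ a) b) (toℚᵘ-/ (+ suc b) 0) ⟩
    mkℚᵘ (+ a) b ℚᵘ.* mkℚᵘ (+ suc b) 0              ≈⟨ *≡* (ℤ.*-assoc (+ a) (+ suc b) (+ 1)) ⟩
    mkℚᵘ (+ a) 0                                    ≈⟨ toℚᵘ-/ (+ a) 0 ⟨
    toℚᵘ (fromℕ a)                                  ∎)
    where open ℚᵘ.≃-Reasoning

  -- Characterises a fraction by its product with the denominator, so that the normalisation hidden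
  -- in `_/_` does not enter the computations with `evenValue` and `oddValue`.
  /-unique : ∀ a b .{{_ : NonZero b}} {x} → x * fromℕ b ≡ fromℕ a → + a / b ≡ x
  /-unique a b {x} eq = begin
    p                       ≡⟨ *-identityʳ p ⟨
    p * 1ℚ                  ≡⟨ cong (p *_) inverse ⟨
    p * (fromℕ b * r)       ≡⟨ *-assoc p _ _ ⟨
    p * fromℕ b * r         ≡⟨ cong (_* r) (trans (/-*-fromℕ a b) (sym eq)) ⟩
    x * fromℕ b * r         ≡⟨ *-assoc x _ _ ⟩
    x * (fromℕ b * r)       ≡⟨ cong (x *_) inverse ⟩
    x * 1ℚ                  ≡⟨ *-identityʳ x ⟩
    x                       ∎
    where
    open ≡-Reasoning
    p r : ℚ
    p = + a / b
    r = + 1 / b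
    inverse : fromℕ b * r ≡ 1ℚ
    inverse = trans (*-comm (fromℕ b) r) (/-*-fromℕ 1 b)

  -- s, J, B, M, S, h stand for k + 1, k - 1, the size of a branch, d / 2, the depth sum of a branch and
  -- the chromatic number, so that J B + 1 = k ^ M; r and t are the inverses of J and s.
  even-identity : ∀ s r t J B M S h → r * J ≡ 1ℚ → t * s ≡ 1ℚ →
    h + fromℕ 2 * (s * S) ≡ (s * B) * (s * B) + 1ℚ →
    J * S + B ≡ M * (J * B + 1ℚ) →
    h ≡ (s * r) * (s * r) * ((J * B + 1ℚ) - 1ℚ)
          * (((J * B + 1ℚ) - 1ℚ) + t * (fromℕ 2 - J * (M * fromℕ 2)))
        - s * r * (M * fromℕ 2) + 1ℚ
  even-identity s r t J B M S h rJ ts h≡ S≡ = begin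
    h
      ≡⟨ solve 2 (λ h x → h := h :+ x :- x) refl h (fromℕ 2 * (s * S)) ⟩
    h + fromℕ 2 * (s * S) - fromℕ 2 * (s * S)
      ≡⟨ cong₂ (λ x y → x - fromℕ 2 * (s * y)) h≡ S≡′ ⟩
    (s * B) * (s * B) + 1ℚ - fromℕ 2 * (s * (r * (M * (J * B + 1ℚ) - B)))
      ≡⟨ solve 5 (λ s r J B M →
           (s :* B) :* (s :* B) :+ one :- two :* (s :* (r :* (M :* (J :* B :+ one) :- B)))
         := one :* one :* (s :* B :* (s :* B)) :+ one :* one :* (s :* B :* r :* (two :- J :* (M :* two)))
              :- s :* r :* (M :* two) :+ one)
         refl s r J B M ⟩
    -- The ring solver cannot use `rJ` and `ts`. The polynomial is therefore written with factors 1
    -- exactly where `r * J` and `t * s` have to be inserted, and solved again after the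
    -- substitution.
    expansion 1ℚ 1ℚ
      ≡⟨ cong₂ expansion rJ ts ⟨
    expansion (r * J) (t * s)
      ≡⟨ solve 6 (λ s r t J B M →
           (r :* J) :* (r :* J) :* (s :* B :* (s :* B))
             :+ (r :* J) :* (t :* s) :* (s :* B :* r :* (two :- J :* (M :* two)))
             :- s :* r :* (M :* two) :+ one
         := (s :* r) :* (s :* r) :* ((J :* B :+ one) :- one)
              :* (((J :* B :+ one) :- one) :+ t :* (two :- J :* (M :* two)))
              :- s :* r :* (M :* two) :+ one)
         refl s r t J B M ⟩
    _ ∎
    where
    open ≡-Reasoning
    open ℚ.+-*-Solver

    one two : ∀ {n} → Polynomial n
    one = con 1ℚ
    two = con (fromℕ 2)

    expansion : ℚ → ℚ → ℚ
    expansion x y =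
      x * x * (s * B * (s * B)) + x * y * (s * B * r * (fromℕ 2 - J * (M * fromℕ 2)))
        - s * r * (M * fromℕ 2) + 1ℚ

    S≡′ : S ≡ r * (M * (J * B + 1ℚ) - B)
    S≡′ = begin
      S                               ≡⟨ *-identityˡ S ⟨
      1ℚ * S                          ≡⟨ cong (_* S) rJ ⟨
      r * J * S                       ≡⟨ solve 4 (λ r J S B → r :* J :* S := r :* (J :* S :+ B :- B)) refl r J S B ⟩
      r * (J * S + B - B)             ≡⟨ cong (λ x → r * (x - B)) S≡ ⟩
      r * (M * (J * B + 1ℚ) - B)      ∎

  -- K, J, M, S, h stand for k, k - 1, (d - 1) / 2, the depth sum of a branch and the chromatic number;
  -- B is the size of a branch without its last level, so that J B + 1 = k ^ M; r is the inverse of J.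
  odd-identity : ∀ K r J B M S h → r * J ≡ 1ℚ →
    let N = 1ℚ + fromℕ 2 * (K * B) in
    h + fromℕ 2 * (fromℕ 2 * S) + N ≡ N * N →
    J * S + K * B ≡ M * (K * (J * B + 1ℚ)) →
    h ≡ fromℕ 4 * K * (r * r) * ((J * B + 1ℚ) - 1ℚ) * (K * ((J * B + 1ℚ) - 1ℚ) + 1ℚ)
      + fromℕ 2 * K * r * (fromℕ 2 - (1ℚ + M * fromℕ 2)) * (J * B + 1ℚ) - fromℕ 2 * K * r
  odd-identity K r J B M S h rJ h≡ S≡ = begin
    h
      ≡⟨ solve 3 (λ h x N → h := h :+ x :+ N :- x :- N) refl h (fromℕ 2 * (fromℕ 2 * S)) N ⟩
    h + fromℕ 2 * (fromℕ 2 * S) + N - fromℕ 2 * (fromℕ 2 * S) - N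
      ≡⟨ cong₂ (λ x y → x - fromℕ 2 * (fromℕ 2 * y) - N) h≡ S≡′ ⟩
    N * N - fromℕ 2 * (fromℕ 2 * (r * (M * (K * (J * B + 1ℚ)) - K * B))) - N
      ≡⟨ solve 5 (λ K r J B M →
           (one :+ two :* (K :* B)) :* (one :+ two :* (K :* B))
             :- two :* (two :* (r :* (M :* (K :* (J :* B :+ one)) :- K :* B)))
             :- (one :+ two :* (K :* B))
         := four :* one :* one :* (K :* B) :* (K :* B) :+ four :* one :* (K :* B :* r)
              :+ two :* one :* (K :* B) :- four :* (K :* r :* M :* (J :* B :+ one)))
         refl K r J B M ⟩
    expansion 1ℚ
      ≡⟨ cong expansion rJ ⟨
    expansion (r * J)
      ≡⟨ solve 5 (λ K r J B M →
           four :* (r :* J) :* (r :* J) :* (K :* B) :* (K :* B) :+ four :* (r :* J) :* (K :* B :* r)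
             :+ two :* (r :* J) :* (K :* B) :- four :* (K :* r :* M :* (J :* B :+ one))
         := four :* K :* (r :* r) :* ((J :* B :+ one) :- one) :* (K :* ((J :* B :+ one) :- one) :+ one)
              :+ two :* K :* r :* (two :- (one :+ M :* two)) :* (J :* B :+ one) :- two :* K :* r)
         refl K r J B M ⟩
    _ ∎
    where
    open ≡-Reasoning
    open ℚ.+-*-Solver

    one two four : ∀ {n} → Polynomial n
    one  = con 1ℚ
    two  = con (fromℕ 2)
    four = con (fromℕ 4)

    N : ℚ
    N = 1ℚ + fromℕ 2 * (K * B)

    expansion : ℚ → ℚ
    expansion x =
      fromℕ 4 * x * x * (K * B) * (K * B) + fromℕ 4 * x * (K * B * r)
        + fromℕ 2 * x * (K * B) - fromℕ 4 * (K * r * M * (J * B + 1ℚ))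

    S≡′ : S ≡ r * (M * (K * (J * B + 1ℚ)) - K * B)
    S≡′ = begin
      S
        ≡⟨ *-identityˡ S ⟨
      1ℚ * S
        ≡⟨ cong (_* S) rJ ⟨
      r * J * S
        ≡⟨ solve 5 (λ r J S K B → r :* J :* S := r :* (J :* S :+ K :* B :- K :* B)) refl r J S K B ⟩
      r * (J * S + K * B - K * B)
        ≡⟨ cong (λ x → r * (x - K * B)) S≡ ⟩
      r * (M * (K * (J * B + 1ℚ)) - K * B) ∎

  size-power : ∀ j h → j ℕ.* size (suc j) h ℕ.+ 1 ≡ suc j ℕ.^ suc h
  size-power j zero    = eq j
    where
    eq : ∀ j → j ℕ.* 1 ℕ.+ 1 ≡ suc j ℕ.* 1
    eq = solve-∀
  size-power j (suc h) = trans (eq j (size (suc j) h)) (cong (suc j ℕ.*_) (size-power j h))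
    where
    eq : ∀ j s → j ℕ.* suc (suc j ℕ.* s) ℕ.+ 1 ≡ suc j ℕ.* (j ℕ.* s ℕ.+ 1)
    eq = solve-∀

  -- Summation by parts: multiplied by j = k - 1, the sum of (ℓ + i) k^i over the levels i
  -- telescopes, leaving a geometric sum that `size` absorbs. The starting depth ℓ is arbitrary
  -- because the induction passes to children at depth `suc ℓ`.
  depthSum-power : ∀ j h ℓ →
    j ℕ.* depthSum (suc j) h ℓ ℕ.+ ℓ ℕ.+ size (suc j) h ≡ (ℓ ℕ.+ h) ℕ.* suc j ℕ.^ suc h ℕ.+ 1
  depthSum-power j zero    ℓ = eq j ℓ
    where
    eq : ∀ j ℓ → j ℕ.* ℓ ℕ.+ ℓ ℕ.+ 1 ≡ (ℓ ℕ.+ 0) ℕ.* (suc j ℕ.* 1) ℕ.+ 1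
    eq = solve-∀
  depthSum-power j (suc h) ℓ = ℕ.+-cancelʳ-≡ (suc j) _ _ (begin
    j ℕ.* (ℓ ℕ.+ suc j ℕ.* S) ℕ.+ ℓ ℕ.+ suc (suc j ℕ.* s) ℕ.+ suc j  ≡⟨ eq₁ j ℓ S s ⟩
    suc j ℕ.* (j ℕ.* S ℕ.+ suc ℓ ℕ.+ s) ℕ.+ 1
      ≡⟨ cong (λ x → suc j ℕ.* x ℕ.+ 1) (depthSum-power j h (suc ℓ)) ⟩
    suc j ℕ.* ((suc ℓ ℕ.+ h) ℕ.* q ℕ.+ 1) ℕ.+ 1                      ≡⟨ eq₂ j ℓ h q ⟩
    (ℓ ℕ.+ suc h) ℕ.* (suc j ℕ.* q) ℕ.+ 1 ℕ.+ suc j                  ∎)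
    where
    open ≡-Reasoning
    S s q : ℕ
    S = depthSum (suc j) h (suc ℓ)
    s = size (suc j) h
    q = suc j ℕ.^ suc h
    eq₁ : ∀ j ℓ S s →
          j ℕ.* (ℓ ℕ.+ suc j ℕ.* S) ℕ.+ ℓ ℕ.+ suc (suc j ℕ.* s) ℕ.+ suc j
          ≡ suc j ℕ.* (j ℕ.* S ℕ.+ suc ℓ ℕ.+ s) ℕ.+ 1
    eq₁ = solve-∀
    eq₂ : ∀ j ℓ h q →
          suc j ℕ.* ((suc ℓ ℕ.+ h) ℕ.* q ℕ.+ 1) ℕ.+ 1 ≡ (ℓ ℕ.+ suc h) ℕ.* (suc j ℕ.* q) ℕ.+ 1 ℕ.+ suc j
    eq₂ = solve-∀

  module Values (i : ℕ) where
    private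
      j k : ℕ
      j = suc i
      k = suc j

      J r : ℚ
      J = fromℕ j
      r = + 1 / j

      rJ : r * J ≡ 1ℚ
      rJ = /-*-fromℕ 1 j

      open ≡-Reasoning

      /j : ∀ a {x} → fromℕ a ≡ x → + a / j ≡ x * r
      /j a {x} refl = /-unique a j (begin
        x * r * J     ≡⟨ *-assoc x r J ⟩
        x * (r * J)   ≡⟨ cong (x *_) rJ ⟩
        x * 1ℚ        ≡⟨ *-identityʳ x ⟩
        x             ∎)

      /j² : ∀ a {x} → fromℕ a ≡ x → + a / (j ℕ.^ 2) ≡ x * (r * r)
      /j² a {x} refl = /-unique a (j ℕ.^ 2) (begin
        x * (r * r) * fromℕ (j ℕ.^ 2)
          ≡⟨ cong (x * (r * r) *_) (fromℕ-² j) ⟩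
        x * (r * r) * (J * J)
          ≡⟨ solve 3 (λ x r J → x :* (r :* r) :* (J :* J) := x :* (r :* J) :* (r :* J)) refl x r J ⟩
        x * (r * J) * (r * J)
          ≡⟨ cong (λ y → x * y * y) rJ ⟩
        x * 1ℚ * 1ℚ
          ≡⟨ trans (*-identityʳ _) (*-identityʳ x) ⟩
        x ∎)
        where open ℚ.+-*-Solver

      q≡ : ∀ m → fromℕ (k ℕ.^ suc m) ≡ J * fromℕ (size k m) + 1ℚ
      q≡ m = begin
        fromℕ (k ℕ.^ suc m)              ≡⟨ cong fromℕ (size-power j m) ⟨
        fromℕ (j ℕ.* size k m ℕ.+ 1)     ≡⟨ fromℕ-+ (j ℕ.* size k m) 1 ⟩
        fromℕ (j ℕ.* size k m) + 1ℚ      ≡⟨ cong (_+ 1ℚ) (fromℕ-* j (size k m)) ⟩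
        J * fromℕ (size k m) + 1ℚ        ∎

    -- Here m is the height of a branch at the centre, so that d / 2 is `suc m` and n - 1 is
    -- `suc k * size k m`. The hypothesis says that h equals (n - 1)² + 1 - 2 Σ f.
    even-value : ∀ m h →
      h ℕ.+ 2 ℕ.* (suc k ℕ.* depthSum k m 1) ≡ (suc k ℕ.* size k m) ℕ.* (suc k ℕ.* size k m) ℕ.+ 1 →
      fromℕ h ≡ evenValue k (suc m ℕ.* 2)
    even-value m h h≡ = begin
      fromℕ h ≡⟨ even-identity s r t J B M S (fromℕ h) rJ (/-*-fromℕ 1 (suc k)) hℚ Sℚ ⟩
      form ((s * r) * (s * r)) (J * B + 1ℚ) (M * fromℕ 2) (s * r)
        ≡⟨ cong (λ α → form α (J * B + 1ℚ) (M * fromℕ 2) (s * r))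
             (solve 2 (λ s r → (s :* r) :* (s :* r) := s :* s :* (r :* r)) refl s r) ⟩
      form (s * s * (r * r)) (J * B + 1ℚ) (M * fromℕ 2) (s * r)
        ≡⟨ cong₂ (λ α q → form α q (M * fromℕ 2) (s * r)) (/j² (suc k ℕ.^ 2) (fromℕ-² (suc k))) (q≡ m) ⟨
      form (+ (suc k ℕ.^ 2) / (j ℕ.^ 2)) (fromℕ (k ℕ.^ suc m)) (M * fromℕ 2) (s * r)
        ≡⟨ cong₂ (form (+ (suc k ℕ.^ 2) / (j ℕ.^ 2)) (fromℕ (k ℕ.^ suc m))) (fromℕ-* (suc m) 2) (/j (suc k) refl) ⟨
      form (+ (suc k ℕ.^ 2) / (j ℕ.^ 2)) (fromℕ (k ℕ.^ suc m)) (fromℕ (suc m ℕ.* 2)) (+ suc k / j)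
        ≡⟨ cong (λ e → form (+ (suc k ℕ.^ 2) / (j ℕ.^ 2)) (fromℕ (k ℕ.^ e)) (fromℕ (suc m ℕ.* 2)) (+ suc k / j))
             (ℕ.m*n/n≡m (suc m) 2) ⟨
      evenValue k (suc m ℕ.* 2) ∎
      where
      open ℚ.+-*-Solver
      s t B M S : ℚ
      s = fromℕ (suc k)
      t = + 1 / suc k
      B = fromℕ (size k m)
      M = fromℕ (suc m)
      S = fromℕ (depthSum k m 1)

      form : ℚ → ℚ → ℚ → ℚ → ℚ
      form α q δ γ = α * (q - 1ℚ) * ((q - 1ℚ) + t * (fromℕ 2 - J * δ)) - γ * δ + 1ℚ

      hℚ : fromℕ h + fromℕ 2 * (s * S) ≡ (s * B) * (s * B) + 1ℚ
      hℚ = begin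
        fromℕ h + fromℕ 2 * (s * S)    ≡⟨ cong (λ x → fromℕ h + fromℕ 2 * x) (fromℕ-* (suc k) (depthSum k m 1)) ⟨
        fromℕ h + fromℕ 2 * fromℕ sS   ≡⟨ cong (λ x → fromℕ h + x) (fromℕ-* 2 sS) ⟨
        fromℕ h + fromℕ (2 ℕ.* sS)     ≡⟨ fromℕ-+ h (2 ℕ.* sS) ⟨
        fromℕ (h ℕ.+ 2 ℕ.* sS)         ≡⟨ cong fromℕ h≡ ⟩
        fromℕ (sB ℕ.* sB ℕ.+ 1)        ≡⟨ fromℕ-+ (sB ℕ.* sB) 1 ⟩
        fromℕ (sB ℕ.* sB) + 1ℚ         ≡⟨ cong (_+ 1ℚ) (fromℕ-* sB sB) ⟩
        fromℕ sB * fromℕ sB + 1ℚ       ≡⟨ cong (λ x → x * x + 1ℚ) (fromℕ-* (suc k) (size k m)) ⟩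
        (s * B) * (s * B) + 1ℚ         ∎
        where
        sS sB : ℕ
        sS = suc k ℕ.* depthSum k m 1
        sB = suc k ℕ.* size k m

      Sℚ : J * S + B ≡ M * (J * B + 1ℚ)
      Sℚ = begin
        J * S + B                                     ≡⟨ cong (_+ B) (fromℕ-* j (depthSum k m 1)) ⟨
        fromℕ (j ℕ.* depthSum k m 1) + B              ≡⟨ fromℕ-+ (j ℕ.* depthSum k m 1) (size k m) ⟨
        fromℕ (j ℕ.* depthSum k m 1 ℕ.+ size k m)     ≡⟨ cong fromℕ (ℕ.+-cancelʳ-≡ 1 _ _
                                                           (trans (eq (j ℕ.* depthSum k m 1) (size k m))
                                                                  (depthSum-power j m 1))) ⟩
        fromℕ (suc m ℕ.* k ℕ.^ suc m)                 ≡⟨ fromℕ-* (suc m) (k ℕ.^ suc m) ⟩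
        M * fromℕ (k ℕ.^ suc m)                       ≡⟨ cong (M *_) (q≡ m) ⟩
        M * (J * B + 1ℚ)                              ∎
        where
        eq : ∀ a b → a ℕ.+ b ℕ.+ 1 ≡ a ℕ.+ 1 ℕ.+ b
        eq = solve-∀

    -- Each end of the central edge carries a tree of height `suc m`, with depths counted from 0;
    -- together they have 2 (1 + k B) vertices with B = `size k m`, so that n - 1 is
    -- `suc (2 * (k * size k m))`.
    odd-value : ∀ m h →
      h ℕ.+ 2 ℕ.* (2 ℕ.* depthSum k (suc m) 0) ℕ.+ suc (2 ℕ.* (k ℕ.* size k m))
        ≡ suc (2 ℕ.* (k ℕ.* size k m)) ℕ.* suc (2 ℕ.* (k ℕ.* size k m)) →
      fromℕ h ≡ oddValue k (suc (suc m ℕ.* 2))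
    odd-value m h h≡ = begin
      fromℕ h ≡⟨ odd-identity K r J B M S (fromℕ h) rJ hℚ Sℚ ⟩
      form (fromℕ 4 * K * (r * r)) (J * B + 1ℚ) (1ℚ + M * fromℕ 2) (fromℕ 2 * K * r)
        ≡⟨ cong₂ (λ α q → form α q (1ℚ + M * fromℕ 2) (fromℕ 2 * K * r)) (/j² (4 ℕ.* k) (fromℕ-* 4 k)) (q≡ m) ⟨
      form (+ (4 ℕ.* k) / (j ℕ.^ 2)) (fromℕ (k ℕ.^ suc m)) (1ℚ + M * fromℕ 2) (fromℕ 2 * K * r)
        ≡⟨ cong₂ (form (+ (4 ℕ.* k) / (j ℕ.^ 2)) (fromℕ (k ℕ.^ suc m))) dℚ (/j (2 ℕ.* k) (fromℕ-* 2 k)) ⟨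
      form (+ (4 ℕ.* k) / (j ℕ.^ 2)) (fromℕ (k ℕ.^ suc m)) (fromℕ (suc (suc m ℕ.* 2))) (+ (2 ℕ.* k) / j)
        ≡⟨ cong (λ e → form (+ (4 ℕ.* k) / (j ℕ.^ 2)) (fromℕ (k ℕ.^ e)) (fromℕ (suc (suc m ℕ.* 2))) (+ (2 ℕ.* k) / j))
             (ℕ.m*n/n≡m (suc m) 2) ⟨
      oddValue k (suc (suc m ℕ.* 2)) ∎
      where
      K B M S : ℚ
      K = fromℕ k
      B = fromℕ (size k m)
      M = fromℕ (suc m)
      S = fromℕ (depthSum k (suc m) 0)

      form : ℚ → ℚ → ℚ → ℚ → ℚ
      form α q δ β = α * (q - 1ℚ) * (K * (q - 1ℚ) + 1ℚ) + β * (fromℕ 2 - δ) * q - β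

      dℚ : fromℕ (suc (suc m ℕ.* 2)) ≡ 1ℚ + M * fromℕ 2
      dℚ = trans (fromℕ-+ 1 (suc m ℕ.* 2)) (cong (λ x → 1ℚ + x) (fromℕ-* (suc m) 2))

      Nℚ : fromℕ (suc (2 ℕ.* (k ℕ.* size k m))) ≡ 1ℚ + fromℕ 2 * (K * B)
      Nℚ = trans (fromℕ-+ 1 (2 ℕ.* (k ℕ.* size k m))) (cong (λ x → 1ℚ + x)
        (trans (fromℕ-* 2 (k ℕ.* size k m)) (cong (fromℕ 2 *_) (fromℕ-* k (size k m)))))

      hℚ : fromℕ h + fromℕ 2 * (fromℕ 2 * S) + (1ℚ + fromℕ 2 * (K * B))
           ≡ (1ℚ + fromℕ 2 * (K * B)) * (1ℚ + fromℕ 2 * (K * B))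
      hℚ = begin
        fromℕ h + fromℕ 2 * (fromℕ 2 * S) + (1ℚ + fromℕ 2 * (K * B))
          ≡⟨ cong₂ (λ x y → fromℕ h + x + y)
               (trans (fromℕ-* 2 (2 ℕ.* D)) (cong (fromℕ 2 *_) (fromℕ-* 2 D))) Nℚ ⟨
        fromℕ h + fromℕ (2 ℕ.* (2 ℕ.* D)) + fromℕ N  ≡⟨ cong (_+ fromℕ N) (fromℕ-+ h (2 ℕ.* (2 ℕ.* D))) ⟨
        fromℕ (h ℕ.+ 2 ℕ.* (2 ℕ.* D)) + fromℕ N      ≡⟨ fromℕ-+ (h ℕ.+ 2 ℕ.* (2 ℕ.* D)) N ⟨
        fromℕ (h ℕ.+ 2 ℕ.* (2 ℕ.* D) ℕ.+ N)          ≡⟨ cong fromℕ h≡ ⟩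
        fromℕ (N ℕ.* N)                              ≡⟨ fromℕ-* N N ⟩
        fromℕ N * fromℕ N                            ≡⟨ cong (λ x → x * x) Nℚ ⟩
        _ ∎
        where
        N D : ℕ
        N = suc (2 ℕ.* (k ℕ.* size k m))
        D = depthSum k (suc m) 0

      Sℚ : J * S + K * B ≡ M * (K * (J * B + 1ℚ))
      Sℚ = begin
        J * S + K * B                                      ≡⟨ cong₂ _+_ (fromℕ-* j D) (fromℕ-* k (size k m)) ⟨
        fromℕ (j ℕ.* D) + fromℕ (k ℕ.* size k m)           ≡⟨ fromℕ-+ (j ℕ.* D) (k ℕ.* size k m) ⟨
        fromℕ (j ℕ.* D ℕ.+ k ℕ.* size k m)                 ≡⟨ cong fromℕ (ℕ.+-cancelʳ-≡ 1 _ _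
                                                                (trans (eq (j ℕ.* D) (k ℕ.* size k m))
                                                                       (depthSum-power j (suc m) 0))) ⟩
        fromℕ (suc m ℕ.* (k ℕ.* k ℕ.^ suc m))              ≡⟨ trans (fromℕ-* (suc m) (k ℕ.* k ℕ.^ suc m))
                                                                (cong (M *_) (fromℕ-* k (k ℕ.^ suc m))) ⟩
        M * (K * fromℕ (k ℕ.^ suc m))                      ≡⟨ cong (λ q → M * (K * q)) (q≡ m) ⟩
        M * (K * (J * B + 1ℚ))                             ∎
        where
        D : ℕ
        D = depthSum k (suc m) 0
        eq : ∀ a b → a ℕ.+ b ℕ.+ 1 ≡ a ℕ.+ 0 ℕ.+ suc b
        eq = solve-∀

open import Data.Fin.Base using (Fin)
open import Data.Fin.Properties using (_≟_)
open import Data.List.Base using (List; []; _∷_; _++_; length; map; filter; concat; concatMap; allFin; head; last)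
open import Data.List.Properties using (length-++; map-++; ++-identityʳ; length-tabulate)
open import Data.List.Membership.Propositional using (_∈_; _∉_; find)
open import Data.List.Membership.Propositional.Properties
  using (∈-allFin; ∈-filter⁺; ∈-filter⁻; ∈-concatMap⁺; ∈-concatMap⁻; ∈-++⁺ˡ; ∈-++⁺ʳ)
open import Data.List.Membership.Propositional.Properties.WithK using (unique∧set⇒bag)
open import Data.List.Relation.Binary.BagAndSetEquality using (∼bag⇒↭)
open import Data.List.Relation.Binary.Disjoint.Propositional using (Disjoint)
open import Data.List.Relation.Binary.Permutation.Propositional
  using (_↭_; ↭-refl; ↭-sym; ↭-trans; ↭-reflexive; ↭-prep; ↭⇒↭ₛ)
import Data.List.Relation.Binary.Permutation.Propositional.Properties as ↭
import Data.List.Relation.Binary.Permutation.Setoid.Properties as ↭ₛ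
open import Data.List.Relation.Unary.All as All using (All; []; _∷_)
import Data.List.Relation.Unary.All.Properties as All
open import Data.List.Relation.Unary.AllPairs as AllPairs using (AllPairs; []; _∷_)
import Data.List.Relation.Unary.AllPairs.Properties as AllPairs
open import Data.List.Relation.Unary.Any as Any using (here; there)
open import Data.List.Relation.Unary.Linked using (Linked; []; [-]; _∷_)
import Data.List.Relation.Unary.Linked.Properties as Linked
open import Data.List.Relation.Unary.Unique.Propositional using (Unique)
import Data.List.Relation.Unary.Unique.Propositional.Properties as Unique
import Data.List.Sort as Sort
open import Data.Maybe.Base using (just; nothing)
open import Data.Maybe.Properties using (just-injective)
open import Data.Maybe.Relation.Binary.Connected as Maybe using (just; nothing; just-nothing; nothing-just)
open import Data.Nat.Base
open import Data.Nat.DivMod using (_/_; _%_; m%n<n; m≡m%n+[m/n]*n)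
open import Data.Nat.ListAction using (sum)
open import Data.Nat.ListAction.Properties using (sum-++; sum-↭)
open import Data.Nat.Properties hiding (_≟_)
open import Data.List.Extrema ≤-totalOrder using (argmax; f[xs]≤f[argmax])
open import Data.Sum.Base using (_⊎_; inj₁; inj₂)
open import Data.Unit.Base using (⊤; tt)
open import Data.Vec.Base as Vec using (Vec; []; _∷_; toList; fromList; cast)
open import Data.Vec.Properties using (toList-cast; toList∘fromList)
open import Function.Base using (_∘_; _on_)
open import Function.Bundles using (mk⇔)
import Relation.Binary.Construct.On as On
open import Relation.Binary.Construct.Closure.ReflexiveTransitive using (ε; _◅_; revApp)
open import Relation.Nullary using (¬_; yes; no; ¬?; contradiction)

-- Walks without backtracking, and distances in a tree.

module Reduction {n : ℕ} (G : Graph n) where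
  open Graph G

  private variable
    o p u v w x y z : Fin n

  -- Backtracking is never allowed: o is the vertex from which the walk is entered.
  ReducedFrom : Fin n → Walk G u v → Set
  ReducedFrom o ε = ⊤
  ReducedFrom {u} o (_◅_ {j = x} _ w) = x ≢ o × ReducedFrom u w

  Reduced : Walk G u v → Set
  Reduced ε = ⊤
  Reduced {u} (_ ◅ w) = ReducedFrom u w

  -- Both walks are reduced and so is the walk running back along the first and then along the second.
  Diverge : Walk G u v → Walk G u w → Set
  Diverge ε q = Reduced q
  Diverge {u} (_◅_ {j = x} _ p) q = ReducedFrom u p × ReducedFrom x q

  ReducedFrom⇒Reduced : (w : Walk G u v) → ReducedFrom o w → Reduced w
  ReducedFrom⇒Reduced ε       _       = tt
  ReducedFrom⇒Reduced (_ ◅ w) (_ , r) = r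

  Diverge⇒Reducedʳ : (p : Walk G u v) (q : Walk G u w) → Diverge p q → Reduced q
  Diverge⇒Reducedʳ ε       q d       = d
  Diverge⇒Reducedʳ (_ ◅ p) q (_ , r) = ReducedFrom⇒Reduced q r

  turn : Walk G u v → Walk G u w → Walk G v w
  turn = revApp adj-sym

  edges-turn : (p : Walk G u v) (q : Walk G u w) →
               edges G (turn p q) ≡ edges G p + edges G q
  edges-turn ε       q = refl
  edges-turn (a ◅ p) q = trans (edges-turn p (adj-sym a ◅ q)) (+-suc (edges G p) (edges G q))

  -- Moving the first edge of p to the front of q, reversed, preserves divergence, so p can be used
  -- up edge by edge.
  turn-reduced : (p : Walk G u v) (q : Walk G u w) → Diverge p q → Reduced (turn p q)
  turn-reduced ε             q d                 = d
  turn-reduced (a ◅ ε)       q (_ , r)           = r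
  turn-reduced (a ◅ (b ◅ p)) q ((x≢u , r) , s) =
    turn-reduced (b ◅ p) (adj-sym a ◅ q) (r , x≢u ∘ sym , s)

  -- The walk p ending at the splitting point is returned reversed.
  split : (p : Walk G u v) (q : Walk G u w) → Diverge p q →
          ∀ i j → edges G q ≡ i + j →
          ∃[ x ] ∃[ p′ ] ∃[ q′ ] Diverge {x} {v} {w} p′ q′ ×
            edges G p′ ≡ i + edges G p × edges G q′ ≡ j
  split p q d zero j eq = _ , p , q , d , refl , eq
  split p ε d (suc i) j ()
  split {u} p (_◅_ {j = y} a q) d (suc i) j eq
    with split (adj-sym a ◅ p) q (diverge p d) i j (suc-injective eq)
    where
    diverge : (p : Walk G u v) → Diverge p (a ◅ q) → Diverge (adj-sym a ◅ p) q
    diverge ε       d                 = tt , d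
    diverge (b ◅ p) (r , x≢y , s) = (x≢y ∘ sym , r) , s
  ... | x , p′ , q′ , d′ , eq₁ , eq₂ =
    x , p′ , q′ , d′ , trans eq₁ (+-suc i (edges G p)) , eq₂

  reduce : (w : Walk G u v) → ∃[ r ] Reduced {u} {v} r × edges G r ≤ edges G w
  reduce ε = ε , tt , z≤n
  reduce {u} (a ◅ w) with reduce w
  ... | ε , _ , _ = a ◅ ε , tt , s≤s z≤n
  ... | _◅_ {j = x} b r , red , le with x ≟ u
  ...   | yes refl = r , ReducedFrom⇒Reduced r red , ≤-trans (n≤1+n _) (m≤n⇒m≤1+n le)
  ...   | no x≢u   = a ◅ b ◅ r , (x≢u , red) , s≤s le

  start∈support : (w : Walk G u v) → u ∈ support G w
  start∈support ε       = here refl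
  start∈support (_ ◅ _) = here refl

  IsPath⇒ReducedFrom : (w : Walk G u v) → o ∉ support G w → IsPath G w → ReducedFrom o w
  IsPath⇒ReducedFrom ε       o∉ _          = tt
  IsPath⇒ReducedFrom (a ◅ w) o∉ (u∉ ∷ uq) =
    (λ { refl → o∉ (there (start∈support w)) }) , IsPath⇒ReducedFrom w (All.All¬⇒¬Any u∉) uq

  IsPath⇒Reduced : (w : Walk G u v) → IsPath G w → Reduced w
  IsPath⇒Reduced ε       _         = tt
  IsPath⇒Reduced (a ◅ w) (u∉ ∷ uq) = IsPath⇒ReducedFrom w (All.All¬⇒¬Any u∉) uq

  -- Serves to cut a path at a vertex that it must not contain, so that the piece closes up to a
  -- cycle. The inclusion of supports is what carries the path property through the induction.
  support-prefix : (w : Walk G u v) → IsPath G w → ReducedFrom o w → z ∈ support G w →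
                   ∃[ w′ ] IsPath G {u} {z} w′ × ReducedFrom o w′ ×
                     (∀ {x} → x ∈ support G w′ → x ∈ support G w)
  support-prefix ε       path       red (here refl) = ε , path , tt , λ x∈ → x∈
  support-prefix (a ◅ w) path       red (here refl) = ε , ([] ∷ []) , tt , λ { (here refl) → here refl }
  support-prefix (a ◅ w) (u∉ ∷ uq) (x≢o , red) (there z∈)
    with support-prefix w uq red z∈
  ... | w′ , path′ , red′ , sub =
    a ◅ w′ , (All.¬Any⇒All¬ _ (All.All¬⇒¬Any u∉ ∘ sub) ∷ path′) , (x≢o , red′) ,
    λ { (here refl) → here refl ; (there x∈) → there (sub x∈) }

  module _ (acyclic : Acyclic G) where

    -- The point where acyclicity is applied. If u recurred in the tail of a reduced walk, the tail
    -- up to that point would be a path from a neighbour of u to u: with no edge it makes the first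
    -- edge a loop, with one edge it backtracks, and with more it is closed to a cycle by the first
    -- edge.
    ReducedFrom⇒IsPath : (w : Walk G u v) → ReducedFrom o w → IsPath G w
    Reduced⇒IsPath     : (w : Walk G u v) → Reduced w → IsPath G w

    ReducedFrom⇒IsPath ε       _       = [] ∷ []
    ReducedFrom⇒IsPath (a ◅ w) (_ , r) = Reduced⇒IsPath (a ◅ w) r

    Reduced⇒IsPath ε       _ = [] ∷ []
    Reduced⇒IsPath {u} (a ◅ w) r = All.¬Any⇒All¬ _ u∉ ∷ path
      where
      path : IsPath G w
      path = ReducedFrom⇒IsPath w r

      u∉ : u ∉ support G w
      u∉ u∈ with support-prefix w path r u∈
      ... | ε , _ = adj-irrefl refl a
      ... | b ◅ ε , _ , (u≢u , _) , _ = u≢u refl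
      ... | b ◅ c ◅ w′ , path′ , _ = acyclic (b ◅ c ◅ w′) path′ (s≤s (s≤s z≤n)) a

    Reduced-closed : (w : Walk G u u) → Reduced w → edges G w ≡ 0
    Reduced-closed ε       _ = refl
    Reduced-closed (a ◅ w) r with u∉ ∷ _ ← Reduced⇒IsPath (a ◅ w) r =
      contradiction (end∈support w) (All.All¬⇒¬Any u∉)
      where
      end∈support : (w : Walk G x y) → y ∈ support G w
      end∈support ε       = here refl
      end∈support (_ ◅ w) = there (end∈support w)

    -- Running back along p and then along q is a closed reduced walk, which is trivial in a tree.
    -- Hence walks that leave u through different neighbours never meet again.
    Diverge-disjoint : (p q : Walk G u v) → Diverge p q → edges G p + edges G q ≡ 0
    Diverge-disjoint p q d = trans (sym (edges-turn p q)) (Reduced-closed _ (turn-reduced p q d))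

    Reduced-edges-unique : (p q : Walk G u v) → Reduced p → Reduced q → edges G p ≡ edges G q
    Reduced-edges-unique ε q _ r = sym (Reduced-closed q r)
    Reduced-edges-unique p@(_ ◅ _) ε r _ = Reduced-closed p r
    Reduced-edges-unique (_◅_ {j = x} a p) (_◅_ {j = y} b q) r s with y ≟ x
    ... | yes refl = cong suc (Reduced-edges-unique p q (ReducedFrom⇒Reduced p r) (ReducedFrom⇒Reduced q s))
    ... | no y≢x with () ← Diverge-disjoint (a ◅ p) (b ◅ q) (r , y≢x , s)

  module Tree (tree : IsTree G) where
    open IsTree tree public
    open Connected connected public

    geodesic : ∀ u v → Walk G u v
    geodesic u v = proj₁ (reduce (walk u v))

    geodesic-reduced : ∀ u v → Reduced (geodesic u v)
    geodesic-reduced u v = proj₁ (proj₂ (reduce (walk u v)))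

    D : Fin n → Fin n → ℕ
    D u v = edges G (geodesic u v)

    D-reduced : (w : Walk G u v) → Reduced w → D u v ≡ edges G w
    D-reduced w r = Reduced-edges-unique acyclic _ w (geodesic-reduced _ _) r

    D-minimal : (w : Walk G u v) → D u v ≤ edges G w
    D-minimal w with reduce w
    ... | r , red , le = subst (_≤ edges G w) (sym (D-reduced r red)) le

    -- The source of the equality cases of D u v ≤ f u + f v + e, and of the contradiction with the
    -- diameter when a branch is too deep.
    D-Diverge : (p : Walk G u v) (q : Walk G u w) → Diverge p q → D v w ≡ edges G p + edges G q
    D-Diverge p q d = trans (D-reduced _ (turn-reduced p q d)) (edges-turn p q)

    D-triangle : ∀ u v w → D v w ≤ D u v + D u w
    D-triangle u v w = subst (D v w ≤_) (edges-turn (geodesic u v) (geodesic u w)) (D-minimal _)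

    D-refl : ∀ u → D u u ≡ 0
    D-refl u = D-reduced ε tt

    D-sym≤ : ∀ u v → D u v ≤ D v u
    D-sym≤ u v = subst (D u v ≤_) (trans (edges-turn (geodesic v u) ε) (+-identityʳ _)) (D-minimal _)

    D-sym : ∀ u v → D u v ≡ D v u
    D-sym u v = ≤-antisym (D-sym≤ u v) (D-sym≤ v u)

    D-positive : u ≢ v → 1 ≤ D u v
    D-positive {u} {v} u≢v with geodesic u v
    ... | ε     = contradiction refl u≢v
    ... | _ ◅ _ = s≤s z≤n

    D-isDistance : ∀ u v → IsDistance G u v (D u v)
    D-isDistance u v = (geodesic u v , refl) , λ { _ (w , refl) → D-minimal w }

    IsDistance⇒D : ∀ {ℓ} → IsDistance G u v ℓ → ℓ ≡ D u v
    IsDistance⇒D ((w , refl) , least) = ≤-antisym (least _ (_ , refl)) (D-minimal w)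

    IsPath⇒D : (w : Walk G u v) → IsPath G w → edges G w ≡ D u v
    IsPath⇒D w path = sym (D-reduced w (IsPath⇒Reduced w path))

    D-isDetourDistance : ∀ u v → IsDetourDistance G u v (D u v)
    D-isDetourDistance u v =
      (geodesic u v , Reduced⇒IsPath acyclic _ (geodesic-reduced u v) , refl) ,
      λ { _ (w , path , refl) → ≤-reflexive (IsPath⇒D w path) }

    IsDetourDistance⇒D : ∀ {ℓ} → IsDetourDistance G u v ℓ → ℓ ≡ D u v
    IsDetourDistance⇒D ((w , path , refl) , _) = IsPath⇒D w path

-- Orderings of the vertices and the colourings along them.

module _ {A : Set} where

  lastFrom : A → List A → A
  lastFrom x []       = x
  lastFrom _ (y ∷ ys) = lastFrom y ys

  lastFrom-∈ : ∀ x xs → lastFrom x xs ∈ x ∷ xs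
  lastFrom-∈ x []       = here refl
  lastFrom-∈ x (y ∷ ys) = there (lastFrom-∈ y ys)

  ∈-tail : {x v : A} {ys : List A} → v ∈ x ∷ ys → v ≢ x → v ∈ ys
  ∈-tail (here v≡x) v≢x = contradiction v≡x v≢x
  ∈-tail (there v∈) _   = v∈

  last-lastFrom : ∀ x xs → last (x ∷ xs) ≡ just (lastFrom x xs)
  last-lastFrom x []       = refl
  last-lastFrom x (y ∷ ys) = last-lastFrom y ys

unique-complete⇒↭ : ∀ {n} {xs : List (Fin n)} → Unique xs → (∀ v → v ∈ xs) → xs ↭ allFin n
unique-complete⇒↭ uniq complete =
  ∼bag⇒↭ (unique∧set⇒bag uniq (Unique.allFin⁺ _) (mk⇔ (λ _ → ∈-allFin _) (λ _ → complete _)))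

↭-allFin⇒length : ∀ {n} {xs : List (Fin n)} → xs ↭ allFin n → length xs ≡ n
↭-allFin⇒length xs↭ = trans (↭.↭-length xs↭) (length-tabulate _)

module Colouring {n : ℕ} (G : Graph n) (tree : IsTree G) where
  open Reduction.Tree G tree

  private
    N : ℕ
    N = n ∸ 1

    gap : Fin n → Fin n → ℕ
    gap u v = N ∸ D u v

  span : Fin n → List (Fin n) → ℕ
  span x []       = 0
  span x (y ∷ ys) = gap x y + span y ys

  -- The greedy colouring: each vertex exceeds its predecessor by just what the condition on these
  -- two demands. The default 0 at `[]` gives the last vertex, and anything off the list, the full
  -- `span`.
  colour : Fin n → List (Fin n) → Fin n → ℕ
  colour x []       v = 0
  colour x (y ∷ ys) v with v ≟ x
  ... | yes _ = 0
  ... | no  _ = gap x y + colour y ys v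

  colour≤span : ∀ x xs v → colour x xs v ≤ span x xs
  colour≤span x []       v = z≤n
  colour≤span x (y ∷ ys) v with v ≟ x
  ... | yes _ = z≤n
  ... | no  _ = +-monoʳ-≤ (gap x y) (colour≤span y ys v)

  colour-last : ∀ x xs → Unique (x ∷ xs) → colour x xs (lastFrom x xs) ≡ span x xs
  colour-last x []       _ = refl
  colour-last x (y ∷ ys) (x∉ ∷ uniq) with lastFrom y ys ≟ x
  ... | yes l≡x = contradiction (sym l≡x) (All.lookup x∉ (lastFrom-∈ y ys))
  ... | no  _   = cong (gap x y +_) (colour-last y ys uniq)

  module _ {d : ℕ} (D≤d : ∀ u v → D u v ≤ d) (2d≤n : 2 * d ≤ n) where

    -- Two consecutive gaps already add up to at least N - 1, so that only adjacent
    -- vertices of the ordering matter.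
    colour-first : ∀ x y ys v → v ∈ y ∷ ys → x ≢ v → N ≤ D x v + (gap x y + colour y ys v)
    colour-first x y ys v v∈ x≢v with v ≟ y
    colour-first x y ys v v∈ x≢v | yes refl = begin
      N                                  ≤⟨ m≤n+m∸n N (D x v) ⟩
      D x v + gap x v                    ≤⟨ +-monoʳ-≤ (D x v) (m≤m+n (gap x v) _) ⟩
      D x v + (gap x v + colour v ys v)  ∎
      where open ≤-Reasoning
    colour-first x y ys v (here v≡y) x≢v | no v≢y = contradiction v≡y v≢y
    colour-first x y (z ∷ zs) v (there _) x≢v | no v≢y with v ≟ y
    ... | yes v≡y = contradiction v≡y v≢y
    ... | no _    = begin
      -- Since 2 d ≤ n = N + 1, the two gaps may fall short of N by one; the missing unit is
      -- supplied by D x v ≥ 1.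
      N                                                ≤⟨ bound ⟩
      1 + (gap x y + gap y z)                          ≤⟨ +-monoˡ-≤ _ (D-positive x≢v) ⟩
      D x v + (gap x y + gap y z)                      ≤⟨ +-monoʳ-≤ (D x v) (+-monoʳ-≤ (gap x y) (m≤m+n (gap y z) _)) ⟩
      D x v + (gap x y + (gap y z + colour z zs v))    ∎
      where
      open ≤-Reasoning

      N≤d+gap : ∀ a b → N ≤ d + gap a b
      N≤d+gap a b = ≤-trans (m≤n+m∸n N (D a b)) (+-monoˡ-≤ (gap a b) (D≤d a b))

      eq₁ : ∀ d a b → (d + a) + (d + b) ≡ 2 * d + (a + b)
      eq₁ = solve-∀

      eq₂ : ∀ m a → 1 + m + a ≡ m + (1 + a)
      eq₂ = solve-∀

      bound : N ≤ 1 + (gap x y + gap y z)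
      bound = +-cancelˡ-≤ N _ _ (begin
        N + N                              ≤⟨ +-mono-≤ (N≤d+gap x y) (N≤d+gap y z) ⟩
        (d + gap x y) + (d + gap y z)      ≡⟨ eq₁ d (gap x y) (gap y z) ⟩
        2 * d + (gap x y + gap y z)        ≤⟨ +-monoˡ-≤ _ (≤-trans 2d≤n (m≤n+m∸n n 1)) ⟩
        1 + N + (gap x y + gap y z)        ≡⟨ eq₂ N (gap x y + gap y z) ⟩
        N + (1 + (gap x y + gap y z))      ∎)

    colour-proper : ∀ x xs {u v} → u ∈ x ∷ xs → v ∈ x ∷ xs → u ≢ v →
      N ≤ D u v + ∣ colour x xs u - colour x xs v ∣
    colour-proper x [] (here refl) (here refl) u≢v = contradiction refl u≢v
    colour-proper x (y ∷ ys) {u} {v} u∈ v∈ u≢v with u ≟ x | v ≟ x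
    ... | yes refl | yes refl = contradiction refl u≢v
    ... | yes refl | no v≢x   = colour-first x y ys v (∈-tail v∈ v≢x) u≢v
    ... | no u≢x   | yes refl = subst₂ (λ a b → N ≤ a + b) (D-sym x u) (sym (∣-∣-identityʳ _))
      (colour-first x y ys u (∈-tail u∈ u≢x) (u≢v ∘ sym))
    ... | no u≢x   | no v≢x   = subst (λ a → N ≤ D u v + a) (sym (∣m+n-m+o∣≡∣n-o∣ (gap x y) _ _))
      (colour-proper y ys (∈-tail u∈ u≢x) (∈-tail v∈ v≢x) u≢v)

  module _ (f : Fin n → ℕ) (e : ℕ) where

    Additive : Fin n → Fin n → Set
    Additive u v = D u v ≡ f u + f v + e

    weight : List (Fin n) → ℕ
    weight xs = sum (map f xs)

    -- Summing the colouring condition over consecutive vertices, each f is counted twice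
    -- except at the two ends.
    span-lower-bound : (∀ {u v} → u ≢ v → D u v ≤ f u + f v + e) →
      ∀ {c} → IsHamiltonianColoring G c →
      ∀ x xs → Linked (λ u v → c u ≤ c v) (x ∷ xs) → Unique (x ∷ xs) →
      let l = lastFrom x xs in
      c x + (f x + f l) + length xs * N ≤ c l + 2 * weight (x ∷ xs) + length xs * e
    span-lower-bound D≤ {c} ham x [] _ _ = ≤-reflexive (eq (c x) (f x))
      where
      eq : ∀ a b → a + (b + b) + 0 ≡ a + 2 * (b + 0) + 0
      eq = solve-∀
    span-lower-bound D≤ {c} ham x (y ∷ ys) (cx≤cy ∷ sorted) ((x≢y ∷ _) ∷ uniq) =
      +-cancelˡ-≤ (c y + f y) _ _ (begin
        c y + f y + (c x + (f x + f l) + (N + L * N))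
          ≡⟨ eq₁ (c y) (f y) (c x) (f x) (f l) N (L * N) ⟩
        (c x + N) + f x + (c y + (f y + f l) + L * N)
          ≤⟨ +-mono-≤ (+-monoˡ-≤ (f x) step) ih ⟩
        (f x + f y + e + c y) + f x + (c l + 2 * weight (y ∷ ys) + L * e)
          ≡⟨ eq₂ (c y) (f y) (f x) (c l) e (weight (y ∷ ys)) (L * e) ⟩
        c y + f y + (c l + 2 * weight (x ∷ y ∷ ys) + (e + L * e)) ∎)
      where
      open ≤-Reasoning
      l = lastFrom y ys
      L = length ys

      ih : c y + (f y + f l) + L * N ≤ c l + 2 * weight (y ∷ ys) + L * e
      ih = span-lower-bound D≤ ham y ys sorted uniq

      step : c x + N ≤ f x + f y + e + c y
      step = begin
        c x + N                              ≤⟨ +-monoʳ-≤ (c x) (ham x y x≢y _ (D-isDetourDistance x y)) ⟩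
        c x + (D x y + ∣ c x - c y ∣)        ≡⟨ cong (λ z → c x + (D x y + z)) (m≤n⇒∣m-n∣≡n∸m cx≤cy) ⟩
        c x + (D x y + (c y ∸ c x))          ≡⟨ eq₃ (c x) (D x y) (c y ∸ c x) ⟩
        D x y + (c y ∸ c x + c x)            ≡⟨ cong (D x y +_) (m∸n+n≡m cx≤cy) ⟩
        D x y + c y                          ≤⟨ +-monoˡ-≤ (c y) (D≤ x≢y) ⟩
        f x + f y + e + c y                  ∎
        where
        eq₃ : ∀ a b c → a + (b + c) ≡ b + (c + a)
        eq₃ = solve-∀

      eq₁ : ∀ cy fy cx fx fl N LN →
            cy + fy + (cx + (fx + fl) + (N + LN)) ≡ (cx + N) + fx + (cy + (fy + fl) + LN)
      eq₁ = solve-∀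

      eq₂ : ∀ cy fy fx cl e w Le →
            (fx + fy + e + cy) + fx + (cl + 2 * w + Le) ≡ cy + fy + (cl + 2 * (fx + w) + (e + Le))
      eq₂ = solve-∀

    -- The summation of `span-lower-bound` with equality throughout: consecutive vertices are
    -- additive, and D ≤ N makes the truncated subtraction in `gap` exact.
    span-value : (∀ u v → D u v ≤ N) → ∀ x xs → Linked Additive (x ∷ xs) →
      span x xs + 2 * weight (x ∷ xs) + length xs * e ≡ length xs * N + (f x + f (lastFrom x xs))
    span-value D≤N x [] _ = eq (f x)
      where
      eq : ∀ b → 2 * (b + 0) + 0 ≡ b + b
      eq = solve-∀
    span-value D≤N x (y ∷ ys) (additive ∷ linked) = begin
      gap x y + span y ys + 2 * weight (x ∷ y ∷ ys) + (e + L * e)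
        ≡⟨ eq₁ (gap x y) (span y ys) (f x) (weight (y ∷ ys)) e (L * e) ⟩
      gap x y + f x + e + f x + (span y ys + 2 * weight (y ∷ ys) + L * e)
        ≡⟨ cong (gap x y + f x + e + f x +_) (span-value D≤N y ys linked) ⟩
      gap x y + f x + e + f x + (L * N + (f y + f l))
        ≡⟨ eq₂ (gap x y) (f x) e (L * N) (f y) (f l) ⟩
      gap x y + (f x + f y + e) + L * N + (f x + f l)
        ≡⟨ cong (λ z → gap x y + z + L * N + (f x + f l)) additive ⟨
      gap x y + D x y + L * N + (f x + f l)
        ≡⟨ cong (λ z → z + L * N + (f x + f l)) (m∸n+n≡m (D≤N x y)) ⟩
      N + L * N + (f x + f l) ∎
      where
      open ≡-Reasoning
      l = lastFrom y ys
      L = length ys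

      eq₁ : ∀ g s fx w e Le → g + s + 2 * (fx + w) + (e + Le) ≡ g + fx + e + fx + (s + 2 * w + Le)
      eq₁ = solve-∀

      eq₂ : ∀ g fx e LN fy fl → g + fx + e + fx + (LN + (fy + fl)) ≡ g + (fx + fy + e) + LN + (fx + fl)
      eq₂ = solve-∀

    module _ {d : ℕ} (D≤d : ∀ u v → D u v ≤ d) (2d≤n : 2 * d ≤ n) where

      -- The number b is a lower bound for f at the two ends of any ordering, and the given ordering
      -- attains it. As the weight does not depend on the ordering, the greedy colouring then meets
      -- the lower bound for every colouring, taken along its own sorted order.
      hamiltonian-number :
        (∀ {u v} → u ≢ v → D u v ≤ f u + f v + e) →
        ∀ {b} → (∀ {u v} → u ≢ v → b ≤ f u + f v) →
        ∀ order {x l} → Unique order → (∀ v → v ∈ order) → Linked Additive order →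
        head order ≡ just x → last order ≡ just l → x ≢ l → f x + f l ≡ b →
        ∃[ h ] IsHamiltonianChromaticNumber G h ×
          h + 2 * weight order + N * e ≡ N * N + b
      hamiltonian-number D≤ b≤ (x ∷ []) _ _ _ refl refl x≢l _ = contradiction refl x≢l
      hamiltonian-number D≤ {b} b≤ (x ∷ y ∷ ys) uniq complete linked refl last≡ _ ends =
        h , ((colour x xs , proper , maximal) , least) , value
        where
        xs : List (Fin n)
        xs = y ∷ ys

        h : ℕ
        h = span x xs

        D≤N : ∀ u v → D u v ≤ N
        D≤N u v = ∸-monoˡ-≤ 1 (begin
          suc (D u v)  ≤⟨ s≤s (D≤d u v) ⟩
          suc d        ≤⟨ +-monoˡ-≤ d 1≤d ⟩
          d + d        ≡⟨ cong (d +_) (+-identityʳ d) ⟨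
          2 * d        ≤⟨ 2d≤n ⟩
          n            ∎)
          where
          open ≤-Reasoning
          1≤d : 1 ≤ d
          1≤d = ≤-trans (D-positive (All.head (AllPairs.head uniq))) (D≤d x y)

        length-order : length (x ∷ xs) ≡ n
        length-order = ↭-allFin⇒length (unique-complete⇒↭ uniq complete)

        ends′ : f x + f (lastFrom x xs) ≡ b
        ends′ = trans (cong (λ z → f x + f z) (just-injective (trans (sym (last-lastFrom x xs)) last≡))) ends

        value : h + 2 * weight (x ∷ xs) + N * e ≡ N * N + b
        value = subst₂ (λ L b → h + 2 * weight (x ∷ xs) + L * e ≡ L * N + b) (cong pred length-order) ends′
                  (span-value D≤N x xs linked)

        proper : IsHamiltonianColoring G (colour x xs)
        proper u v u≢v m detour with refl ← IsDetourDistance⇒D detour =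
          colour-proper D≤d 2d≤n x xs (complete u) (complete v) u≢v

        maximal : IsMaxColor G (colour x xs) h
        maximal = (lastFrom x xs , colour-last x xs uniq) , λ { _ (v , refl) → colour≤span x xs v }

        least : ∀ m → (∃[ c ] IsHamiltonianColoring G c × IsMaxColor G c m) → h ≤ m
        least m (c , ham , _ , max) = go (sort (allFin n)) (sort-↭ (allFin n)) (sort-↗ (allFin n))
          where
          open Sort (On.decTotalOrder ≤-decTotalOrder c) using (sort; sort-↭; sort-↗)

          go : ∀ zs → zs ↭ allFin n → Linked (λ u v → c u ≤ c v) zs → h ≤ m
          go []       zs↭ _ with () ← trans (↭-allFin⇒length zs↭) (sym length-order)
          go (z ∷ []) zs↭ _ with () ← trans (↭-allFin⇒length zs↭) (sym length-order)
          go (z ∷ z′ ∷ zs) zs↭ sorted = +-cancelʳ-≤ _ _ _ (begin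
            h + (2 * weight (x ∷ xs) + N * e)         ≡⟨ +-assoc h _ _ ⟨
            h + 2 * weight (x ∷ xs) + N * e           ≡⟨ value ⟩
            -- The ends of the sorted ordering are unknown; all that is used is that they are
            -- distinct. The smallest colour `c z` is estimated by 0.
            N * N + b                                 ≤⟨ +-monoʳ-≤ (N * N) (b≤ z≢l) ⟩
            N * N + (f z + f l)                       ≡⟨ +-comm (N * N) _ ⟩
            f z + f l + N * N                         ≤⟨ m≤n+m _ (c z) ⟩
            c z + (f z + f l + N * N)                 ≡⟨ +-assoc (c z) _ _ ⟨
            c z + (f z + f l) + N * N                 ≤⟨ bound ⟩
            c l + 2 * weight (z ∷ z′ ∷ zs) + N * e    ≡⟨ cong (λ w → c l + 2 * w + N * e) weight≡ ⟩
            c l + 2 * weight (x ∷ xs) + N * e         ≤⟨ +-monoˡ-≤ (N * e) (+-monoˡ-≤ _ (max _ (l , refl))) ⟩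
            m + 2 * weight (x ∷ xs) + N * e           ≡⟨ +-assoc m _ _ ⟩
            m + (2 * weight (x ∷ xs) + N * e)         ∎)
            where
            open ≤-Reasoning
            l : Fin n
            l = lastFrom z′ zs

            zs-unique : Unique (z ∷ z′ ∷ zs)
            zs-unique = ↭ₛ.Unique-resp-↭ (setoid (Fin n)) (↭⇒↭ₛ (↭-sym zs↭)) (Unique.allFin⁺ n)

            z≢l : z ≢ l
            z≢l = All.lookup (AllPairs.head zs-unique) (lastFrom-∈ z′ zs)

            weight≡ : weight (z ∷ z′ ∷ zs) ≡ weight (x ∷ xs)
            weight≡ = sum-↭ (↭.map⁺ f (↭-trans zs↭ (↭-sym (unique-complete⇒↭ uniq complete))))

            bound : c z + (f z + f l) + N * N ≤ c l + 2 * weight (z ∷ z′ ∷ zs) + N * e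
            bound = subst (λ L → c z + (f z + f l) + L * N ≤ c l + 2 * weight (z ∷ z′ ∷ zs) + L * e)
              (cong pred (↭-allFin⇒length zs↭)) (span-lower-bound D≤ ham z (z′ ∷ zs) sorted zs-unique)

-- Branches of a tree: enumeration, size and depth sum.

length≡1 : {A : Set} {xs : List A} {z : A} →
           Unique xs → z ∈ xs → (∀ {y} → y ∈ xs → y ≡ z) → length xs ≡ 1
length≡1 {xs = x ∷ []} _ _ _ = refl
length≡1 {xs = x ∷ y ∷ xs} ((x≢y ∷ _) ∷ _) _ all≡z =
  contradiction (trans (all≡z (here refl)) (sym (all≡z (there (here refl))))) x≢y

Unique⇒AllPairs : {A : Set} {R : A → A → Set} {xs : List A} → Unique xs →
                  (∀ {x y} → x ∈ xs → y ∈ xs → x ≢ y → R x y) → AllPairs R xs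
Unique⇒AllPairs []          r = []
Unique⇒AllPairs (x∉ ∷ uniq) r =
  All.tabulate (λ y∈ → r (here refl) (there y∈) (All.lookup x∉ y∈)) ∷
  Unique⇒AllPairs uniq (λ x∈ y∈ → r (there x∈) (there y∈))

-- Used with `length` to count the vertices of the branches and with `sum ∘ map f` to add up their
-- depths.
concatMap-sum : {A B : Set} (φ : List B → ℕ) → φ [] ≡ 0 → (∀ xs ys → φ (xs ++ ys) ≡ φ xs + φ ys) →
                ∀ {s} (g : A → List B) xs → (∀ {x} → x ∈ xs → φ (g x) ≡ s) →
                φ (concatMap g xs) ≡ length xs * s
concatMap-sum φ φ[] φ++ g []       φg≡s = φ[]
concatMap-sum φ φ[] φ++ g (x ∷ xs) φg≡s = trans (φ++ (g x) _)
  (cong₂ _+_ (φg≡s (here refl)) (concatMap-sum φ φ[] φ++ g xs (φg≡s ∘ there)))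

module Branches {n : ℕ} (G : Graph n) (tree : IsTree G) where
  open Graph G
  open Reduction G
  open Tree tree

  private variable
    o p u v w x y z : Fin n

  neighbours : Fin n → List (Fin n)
  neighbours v = filter (adj? v) (allFin n)

  ∈-neighbours⁺ : Adj v x → x ∈ neighbours v
  ∈-neighbours⁺ {v} {x} a = ∈-filter⁺ (adj? v) (∈-allFin x) a

  ∈-neighbours⁻ : x ∈ neighbours v → Adj v x
  ∈-neighbours⁻ {v = v} x∈ = proj₂ (∈-filter⁻ (adj? v) {xs = allFin n} x∈)

  neighbours-unique : ∀ v → Unique (neighbours v)
  neighbours-unique v = Unique.filter⁺ (adj? v) (Unique.allFin⁺ n)

  children : Fin n → Fin n → List (Fin n)
  children p v = filter (λ x → ¬? (x ≟ p)) (neighbours v)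

  ∈-children⁺ : Adj v x → x ≢ p → x ∈ children p v
  ∈-children⁺ {p = p} a x≢p = ∈-filter⁺ (λ x → ¬? (x ≟ p)) (∈-neighbours⁺ a) x≢p

  ∈-children⁻ : x ∈ children p v → Adj v x × x ≢ p
  ∈-children⁻ {p = p} {v} x∈ with ∈-filter⁻ (λ x → ¬? (x ≟ p)) {xs = neighbours v} x∈
  ... | x∈′ , x≢p = ∈-neighbours⁻ x∈′ , x≢p

  children-unique : ∀ p v → Unique (children p v)
  children-unique p v = Unique.filter⁺ (λ x → ¬? (x ≟ p)) (neighbours-unique v)

  degree-children : Adj v p → degree G v ≡ suc (length (children p v))
  degree-children {v} {p} a = ↭.↭-length (∼bag⇒↭ (unique∧set⇒bag (neighbours-unique v)
    (All.tabulate (λ x∈ p≡x → proj₂ (∈-children⁻ x∈) (sym p≡x)) ∷ children-unique p v)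
    (mk⇔ to from)))
    where
    to : x ∈ neighbours v → x ∈ p ∷ children p v
    to {x} x∈ with x ≟ p
    ... | yes x≡p = here x≡p
    ... | no  x≢p = there (∈-children⁺ (∈-neighbours⁻ x∈) x≢p)

    from : x ∈ p ∷ children p v → x ∈ neighbours v
    from (here refl) = ∈-neighbours⁺ a
    from (there x∈)  = ∈-neighbours⁺ (proj₁ (∈-children⁻ x∈))

  -- Preorder traversal of the part of the tree beyond the edge pv, cut off below depth h to make
  -- the recursion structural; in a `Balanced` branch of height h nothing is lost.
  branch : ℕ → Fin n → Fin n → List (Fin n)
  branch zero    p v = v ∷ []
  branch (suc h) p v = v ∷ concatMap (branch h v) (children p v)

  ∈-branch⁺ : ∀ h (r : Walk G v x) → ReducedFrom p r → edges G r ≤ h → x ∈ branch h p v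
  ∈-branch⁺ zero    ε       _         _        = here refl
  ∈-branch⁺ (suc h) ε       _         _        = here refl
  ∈-branch⁺ {v = v} (suc h) (a ◅ r) (x≢p , red) (s≤s le) =
    there (∈-concatMap⁺ (branch h v) (Any.map (λ { refl → ∈-branch⁺ h r red le }) (∈-children⁺ a x≢p)))

  ∈-branch⁻ : ∀ h → x ∈ branch h p v → ∃[ r ] ReducedFrom {v} {x} p r
  ∈-branch⁻ zero    (here refl) = ε , tt
  ∈-branch⁻ (suc h) (here refl) = ε , tt
  ∈-branch⁻ {v = v} (suc h) (there x∈) with find (∈-concatMap⁻ (branch h v) x∈)
  ... | c , c∈ , x∈′ with ∈-children⁻ c∈ | ∈-branch⁻ h x∈′
  ...   | a , c≢p | r , red = a ◅ r , c≢p , red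

  branch-root : ∀ h p v → ∃[ xs ] branch h p v ≡ v ∷ xs
  branch-root zero    p v = [] , refl
  branch-root (suc h) p v = _ , refl

  root∉branch : ∀ h → Adj p v → p ∉ branch h p v
  root∉branch h a p∈ with ∈-branch⁻ h p∈
  ... | r , red with () ← Reduced-closed acyclic (a ◅ r) red

  branches-disjoint : ∀ h → Adj w u → Adj w v → u ≢ v → Disjoint (branch h w u) (branch h w v)
  branches-disjoint h a b u≢v (x∈ , x∈′) with ∈-branch⁻ h x∈ | ∈-branch⁻ h x∈′
  ... | r , red | s , red′ with () ← Diverge-disjoint acyclic (a ◅ r) (b ◅ s) (red , u≢v ∘ sym , red′)

  branches-unique : ∀ h {xs} → (∀ {p v} → Adj p v → Unique (branch h p v)) →
                    (∀ {x} → x ∈ xs → Adj v x) → Unique xs → Unique (concatMap (branch h v) xs)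
  branches-unique {v} h branch-uniq adj uniq = Unique.concat⁺
    (All.map⁺ (All.tabulate (branch-uniq ∘ adj)))
    (AllPairs.map⁺ (Unique⇒AllPairs uniq
      (λ x∈ y∈ → branches-disjoint h (adj x∈) (adj y∈))))

  branch-unique : ∀ h → Adj p v → Unique (branch h p v)
  branch-unique zero    a = [] ∷ []
  branch-unique {p} {v} (suc h) a = All.tabulate v≢ ∷
    branches-unique h (branch-unique h) (proj₁ ∘ ∈-children⁻) (children-unique p v)
    where
    v≢ : ∀ {x} → x ∈ concatMap (branch h v) (children p v) → v ≢ x
    v≢ x∈ refl with find (∈-concatMap⁻ (branch h v) x∈)
    ... | c , c∈ , v∈ = root∉branch h (proj₁ (∈-children⁻ c∈)) v∈

  -- The component of v after removal of the edge pv, rooted at v, has all its leaves at depth h.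
  record Balanced (p v : Fin n) (h : ℕ) : Set where
    field
      adj        : Adj p v
      depth      : ∀ {x} (r : Walk G v x) → ReducedFrom p r → edges G r ≤ h
      leaf-depth : ∀ {x} (r : Walk G v x) → ReducedFrom p r → IsLeaf G x → h ≤ edges G r

  open Balanced public

  Balanced-child : ∀ {h} → Balanced p v (suc h) → x ∈ children p v → Balanced v x h
  Balanced-child bal x∈ with ∈-children⁻ x∈
  ... | a , x≢p = record
    { adj        = a
    ; depth      = λ r red → s≤s⁻¹ (depth bal (a ◅ r) (x≢p , red))
    ; leaf-depth = λ r red leaf → s≤s⁻¹ (leaf-depth bal (a ◅ r) (x≢p , red) leaf)
    }

  module _ {k : ℕ} (nonleaf-degree : ∀ v → ¬ IsLeaf G v → degree G v ≡ suc k) where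

    -- The root v cannot be a leaf, being at depth 0 < `suc h`; so it has degree k + 1, and one of
    -- its neighbours is p.
    length-children : ∀ {h} → Balanced p v (suc h) → length (children p v) ≡ k
    length-children bal = suc-injective (trans (sym (degree-children (adj-sym (adj bal))))
      (nonleaf-degree _ (λ leaf → contradiction (leaf-depth bal ε tt leaf) (λ ()))))

    length-branch : ∀ h → Balanced p v h → length (branch h p v) ≡ size k h
    length-branch zero    bal = refl
    length-branch {p} {v} (suc h) bal = cong suc (trans
      (concatMap-sum length refl (λ xs ys → length-++ xs {ys}) (branch h v) (children p v)
        (λ x∈ → length-branch h (Balanced-child bal x∈)))
      (cong (_* size k h) (length-children bal)))

    sum-branch : ∀ (f : Fin n → ℕ) h ℓ → Balanced p v h →
                 (∀ {x} (r : Walk G v x) → ReducedFrom p r → f x ≡ ℓ + edges G r) →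
                 sum (map f (branch h p v)) ≡ depthSum k h ℓ
    sum-branch f zero ℓ bal f≡ = trans (+-identityʳ _) (trans (f≡ ε tt) (+-identityʳ ℓ))
    sum-branch {p} {v} f (suc h) ℓ bal f≡ = cong₂ _+_ (trans (f≡ ε tt) (+-identityʳ ℓ)) (trans
      (concatMap-sum (sum ∘ map f) refl
        (λ xs ys → trans (cong sum (map-++ f xs ys)) (sum-++ (map f xs) (map f ys)))
        (branch h v) (children p v)
        (λ x∈ → sum-branch f h (suc ℓ) (Balanced-child bal x∈)
          (λ r red → let a , x≢p = ∈-children⁻ x∈ in
            trans (f≡ (a ◅ r) (x≢p , red)) (+-suc ℓ _))))
      (cong (_* depthSum k h (suc ℓ)) (length-children bal)))

-- The centre of a symmetric tree.

module Center {n : ℕ} (G : Graph n) (sym-tree : IsSymmetricTree G)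
              {d : ℕ} (1≤d : 1 ≤ d) (diameter : IsDiameter G d) where
  open Graph G
  open IsSymmetricTree sym-tree
  open Reduction G
  open Tree isTree
  open Branches G isTree

  private variable
    o p u v w x y z : Fin n

  eccentricity : ∀ u → ∃[ v ] IsEccentricity G u (D u v)
  eccentricity u = farthest , (farthest , D-isDistance u farthest) , λ { _ (w , dist) →
    ≤-trans (≤-reflexive (IsDistance⇒D dist))
            (All.lookup (f[xs]≤f[argmax] {f = D u} u (allFin n)) (∈-allFin w)) }
    where
    farthest : Fin n
    farthest = argmax (D u) u (allFin n)

  D≤d : ∀ u v → D u v ≤ d
  D≤d u v with eccentricity u
  ... | w , ecc = ≤-trans (proj₂ ecc _ (v , D-isDistance u v)) (proj₂ diameter _ (u , ecc))

  -- A second neighbour of u would prolong the geodesic to length d + 1.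
  diametral-end-leaf : D u v ≡ d → IsLeaf G u
  diametral-end-leaf {u} {v} D≡d with geodesic u v | geodesic-reduced u v
  ... | ε | _ = contradiction (subst (1 ≤_) (sym D≡d) 1≤d) (λ ())
  ... | _◅_ {j = z} a w | red = length≡1 (neighbours-unique u) (∈-neighbours⁺ a) only
    where
    only : y ∈ neighbours u → y ≡ z
    only {y} y∈ with y ≟ z
    ... | yes y≡z = y≡z
    ... | no  y≢z = contradiction
      (subst₂ _≤_ (D-reduced (adj-sym (∈-neighbours⁻ y∈) ◅ a ◅ w) (y≢z ∘ sym , red)) (sym D≡d) (D≤d y v))
      1+n≰n

  -- The end of a diametral geodesic is a leaf of eccentricity d, and all leaves have the same
  -- eccentricity.
  leaf-far : IsLeaf G x → ∃[ y ] D x y ≡ d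
  leaf-far {x} leaf with proj₁ diameter
  ... | u , ecc@((v , dist) , _) with eccentricity x
  ...   | y , ecc′ = y , leaf-eccentricity x u leaf
    (diametral-end-leaf {v = v} (sym (IsDistance⇒D dist))) _ _ ecc′ ecc

  diametral-walk : ∃[ u ] ∃[ v ] ∃[ w ] Reduced {u} {v} w × edges G w ≡ d
  diametral-walk with proj₁ diameter
  ... | u , (v , dist) , _ = u , v , geodesic u v , geodesic-reduced u v , sym (IsDistance⇒D dist)

  -- The midpoint w of a diametral walk. The two halves leave w through different neighbours, so
  -- every branch at w is avoided by one of them; joined to that half, a walk deeper than m in the
  -- branch would exceed d. Hence w has radius at most m + 1, and a leaf, having some vertex at
  -- distance d, is at distance at least m + 1 from w.
  center : ∀ {m} → d ≡ suc m + suc m → ∃[ w ] ∀ {z} → Adj w z → Balanced w z m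
  center {m} d≡ with diametral-walk
  ... | u , v , g , red , len with split ε g red (suc m) (suc m) (trans len d≡)
  ... | _ , ε , _ , _ , () , _
  ... | _ , _ ◅ _ , ε , _ , _ , ()
  ... | w , p@(_◅_ {j = t} a p′) , q@(_◅_ {j = t′} b q′) , (redp , t′≢t , redq) , lp , lq =
    w , λ a → record { adj = a ; depth = depth′ a ; leaf-depth = leaf-depth′ a }
    where
    cancel : ∀ {i} → suc m + suc i ≤ d → i ≤ m
    cancel le = s≤s⁻¹ (+-cancelˡ-≤ (suc m) _ _ (subst (_ ≤_) d≡ le))

    depth′ : Adj w z → (r : Walk G z x) → ReducedFrom w r → edges G r ≤ m
    depth′ {z} {x} c r red with z ≟ t
    ... | yes refl = cancel (subst (_≤ d)
          (trans (D-Diverge q (c ◅ r) (redq , t′≢t ∘ sym , red)) (cong (_+ suc (edges G r)) lq)) (D≤d v x))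
    ... | no z≢t   = cancel (subst (_≤ d)
          (trans (D-Diverge p (c ◅ r) (redp , z≢t , red))
                 (cong (_+ suc (edges G r)) (trans lp (+-identityʳ _)))) (D≤d u x))

    radius : ∀ y → D w y ≤ suc m
    radius y with geodesic w y | geodesic-reduced w y
    ... | ε     | _   = z≤n
    ... | c ◅ r | red = s≤s (depth′ c r red)

    leaf-depth′ : Adj w z → (r : Walk G z x) → ReducedFrom w r → IsLeaf G x → m ≤ edges G r
    leaf-depth′ {x = x} c r red leaf with leaf-far leaf
    ... | y , D≡d = s≤s⁻¹ (+-cancelʳ-≤ (suc m) _ _ (begin
      suc m + suc m             ≡⟨ trans D≡d d≡ ⟨
      D x y                     ≤⟨ D-triangle w x y ⟩
      D w x + D w y             ≤⟨ +-mono-≤ (≤-reflexive (D-reduced (c ◅ r) red)) (radius y) ⟩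
      suc (edges G r) + suc m   ∎))
      where open ≤-Reasoning

  -- The diametral walk is split after m of its 2 m + 1 edges, so that `q` begins with the central
  -- edge. Walks on the side of w are compared with `q`; walks on the side of w′, prolonged by the
  -- central edge, with `p`, which may be trivial.
  central-edge : ∀ {m} → d ≡ suc (m + m) → ∃[ w ] ∃[ w′ ] Balanced w′ w m × Balanced w w′ m
  central-edge {m} d≡ with diametral-walk
  ... | u , v , g , red , len with split ε g red m (suc m) (trans len (trans d≡ (sym (+-suc m m))))
  ... | _ , _ , ε , _ , _ , ()
  ... | w , p , q@(_◅_ {j = w′} c q′) , div , lp , lq =
    w , w′ ,
    record
      { adj        = adj-sym c
      ; depth      = depth-w
      ; leaf-depth = λ r red → leaf-depth′ (radius c depth-w depth-w′) r (ReducedFrom⇒Reduced r red)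
      } ,
    record
      { adj        = c
      ; depth      = depth-w′
      ; leaf-depth = λ r red → leaf-depth′ (radius (adj-sym c) depth-w′ depth-w) r (ReducedFrom⇒Reduced r red)
      }
    where
    Depth : Fin n → Fin n → Set
    Depth o v = ∀ {x} (r : Walk G v x) → ReducedFrom o r → edges G r ≤ m

    depth-w : Depth w′ w
    depth-w {x} r red = +-cancelˡ-≤ (suc m) _ _ (subst₂ _≤_
      (trans (D-Diverge q r (diverge-q , red)) (cong (_+ edges G r) lq)) d≡ (D≤d v x))
      where
      diverge-q : ReducedFrom w q′
      diverge-q = Diverge⇒Reducedʳ p q div

    depth-w′ : Depth w w′
    depth-w′ {x} r red = +-cancelˡ-≤ (suc m) _ _ (subst₂ _≤_
      (trans (D-Diverge p (c ◅ r) (diverge p div))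
             (trans (cong (_+ suc (edges G r)) (trans lp (+-identityʳ m))) (+-suc m _)))
      d≡ (D≤d u x))
      where
      diverge : (p : Walk G w u) → Diverge p q → Diverge p (c ◅ r)
      diverge ε       _                    = red
      diverge (_ ◅ _) (redp , w′≢t , _) = redp , w′≢t , red

    radius : Adj x y → Depth y x → Depth x y → ∀ z → D x z ≤ suc m
    radius {x} {y} a depth-x depth-y z with geodesic x z | geodesic-reduced x z
    ... | ε | _ = z≤n
    ... | _◅_ {j = t} b r | red with t ≟ y
    ...   | yes refl = s≤s (depth-y r red)
    ...   | no t≢y   = m≤n⇒m≤1+n (depth-x (b ◅ r) (t≢y , red))

    leaf-depth′ : (∀ z → D y z ≤ suc m) → (r : Walk G y x) → Reduced r → IsLeaf G x → m ≤ edges G r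
    leaf-depth′ {y} {x} rad r red leaf with leaf-far leaf
    ... | z , D≡d = +-cancelʳ-≤ (suc m) _ _ (begin
      m + suc m            ≡⟨ +-suc m m ⟩
      suc (m + m)          ≡⟨ trans D≡d d≡ ⟨
      D x z                ≤⟨ D-triangle y x z ⟩
      D y x + D y z        ≤⟨ +-mono-≤ (≤-reflexive (D-reduced r red)) (rad z) ⟩
      edges G r + suc m    ∎)
      where open ≤-Reasoning

-- Visiting several lists of equal length in turn.

module _ {A : Set} where

  toVec : ∀ {N} (xs : List A) → length xs ≡ N → ∃[ v ] toList {n = N} v ≡ xs
  toVec xs eq = cast eq (fromList xs) , trans (toList-cast eq (fromList xs)) (toList∘fromList xs)

  columns : ∀ {N} (xss : List (List A)) → All (λ xs → length xs ≡ N) xss →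
            ∃[ vs ] map (toList {n = N}) vs ≡ xss
  columns []         []         = [] , refl
  columns (xs ∷ xss) (eq ∷ eqs) with toVec xs eq | columns xss eqs
  ... | v , refl | vs , refl = v ∷ vs , refl

  last⇒∈ : ∀ (xs : List A) {x} → last xs ≡ just x → x ∈ xs
  last⇒∈ (x ∷ [])     refl = here refl
  last⇒∈ (x ∷ y ∷ xs) eq   = there (last⇒∈ (y ∷ xs) eq)

  last-++-∷ : ∀ xs (y : A) → last (xs ++ y ∷ []) ≡ just y
  last-++-∷ []           y = refl
  last-++-∷ (x ∷ [])     y = refl
  last-++-∷ (x ∷ z ∷ xs) y = last-++-∷ (z ∷ xs) y

  connected⁺ : {R : A → A → Set} (xs ys : List A) →
    (∀ {x y} → last xs ≡ just x → head ys ≡ just y → R x y) → Maybe.Connected R (last xs) (head ys)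
  connected⁺ xs ys r with last xs | head ys
  ... | just x  | just y  = just (r refl refl)
  ... | just x  | nothing = just-nothing
  ... | nothing | just y  = nothing-just
  ... | nothing | nothing = nothing

  -- The columns are read row by row; vectors ensure that every round meets every column.
  rounds : ∀ N → List (Vec A N) → List A
  rounds zero    vs = []
  rounds (suc N) vs = map Vec.head vs ++ rounds N (map Vec.tail vs)

  rounds-↭ : ∀ N vs → rounds N vs ↭ concatMap toList vs
  rounds-↭ zero    vs = ↭-reflexive (sym (empty vs))
    where
    empty : ∀ vs → concatMap toList vs ≡ []
    empty []        = refl
    empty ([] ∷ vs) = empty vs
  rounds-↭ (suc N) vs = ↭-trans (↭.++⁺ˡ (map Vec.head vs) (rounds-↭ N (map Vec.tail vs))) (heads-tails vs)
    where
    heads-tails : ∀ {N} (vs : List (Vec A (suc N))) →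
      map Vec.head vs ++ concatMap toList (map Vec.tail vs) ↭ concatMap toList vs
    heads-tails []             = ↭-refl
    heads-tails ((x ∷ v) ∷ vs) = ↭-prep x (↭-trans (↭.shifts (map Vec.head vs) (toList v))
      (↭.++⁺ˡ (toList v) (heads-tails vs)))

  head-rounds : ∀ {N} (v : Vec A N) vs ws {x xs} → toList v ≡ x ∷ xs →
                head (rounds N (v ∷ vs) ++ ws) ≡ just x
  head-rounds (x ∷ v) vs ws refl = refl

  last-rounds : ∀ {N} (u v : Vec A N) → last (rounds N (u ∷ v ∷ [])) ≡ last (toList v)
  last-rounds []            []            = refl
  last-rounds (x ∷ [])      (y ∷ [])      = refl
  last-rounds (x ∷ x′ ∷ u) (y ∷ y′ ∷ v) = last-rounds (x′ ∷ u) (y′ ∷ v)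

  module _ (R : A → A → Set) where

    -- Both directions occur: within a round the ordering moves to a later column, and between
    -- rounds it returns to the first.
    Across : List A → List A → Set
    Across xs ys = ∀ {x y} → x ∈ xs → y ∈ ys → R x y × R y x

    head-∈ : ∀ {N} (v : Vec A (suc N)) → Vec.head v ∈ toList v
    head-∈ (x ∷ v) = here refl

    Across-tail : ∀ {N} {u v : Vec A (suc N)} → Across (toList u) (toList v) →
                  Across (toList (Vec.tail u)) (toList (Vec.tail v))
    Across-tail {u = _ ∷ _} {_ ∷ _} ac x∈ y∈ = ac (there x∈) (there y∈)

    -- With at least two columns, the last vertex of a round and the first vertex of the next
    -- one lie in different columns.
    rounds-linked : ∀ N {u v vs} → AllPairs (Across on toList) (u ∷ v ∷ vs) → Linked R (rounds N (u ∷ v ∷ vs))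
    rounds-linked zero    _ = []
    rounds-linked (suc N) {u} {v} {vs} ac@(ac-u ∷ _) = Linked.++⁺
      (Linked.AllPairs⇒Linked (AllPairs.map⁺ (AllPairs.map
        (λ {u} {v} ac′ → proj₁ (ac′ (head-∈ u) (head-∈ v))) ac)))
      (connected⁺ (map Vec.head (u ∷ v ∷ vs)) (rounds N (map Vec.tail (u ∷ v ∷ vs)))
        (λ {x} {y} last≡ head≡ →
          crossing {y = y} (last⇒∈ (map Vec.head (v ∷ vs)) last≡) (∈-first N u head≡)))
      (rounds-linked N (AllPairs.map⁺ (AllPairs.map (λ {u} {v} → Across-tail {u = u} {v}) ac)))
      where
      ∈-first : ∀ N (u : Vec A (suc N)) {vs y} → head (rounds N (Vec.tail u ∷ vs)) ≡ just y → y ∈ toList u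
      ∈-first (suc N) (x ∷ y ∷ u) refl = there (here refl)

      crossing : ∀ {x y} → x ∈ map Vec.head (v ∷ vs) → y ∈ toList u → R x y
      crossing x∈ y∈ = All.lookup
        (All.map⁺ {P = λ x → R x _} (All.map (λ {w} ac′ → proj₂ (ac′ y∈ (head-∈ w))) ac-u)) x∈

    -- The last two clauses control the ends of the ordering. The list `ws` leaves room for the
    -- centre, appended when d is even; the clause on `last` is for exactly two columns, the case of
    -- odd d.
    interleave : ∀ {N} xs ys xss → All (λ zs → length zs ≡ N) (xs ∷ ys ∷ xss) →
      AllPairs Across (xs ∷ ys ∷ xss) →
      ∃[ order ] order ↭ concat (xs ∷ ys ∷ xss) × Linked R order ×
        (∀ ws {x xs′} → xs ≡ x ∷ xs′ → head (order ++ ws) ≡ just x) ×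
        (xss ≡ [] → last order ≡ last ys)
    interleave xs ys xss eqs ac with columns (xs ∷ ys ∷ xss) eqs
    ... | u ∷ v ∷ vs , refl =
      rounds _ (u ∷ v ∷ vs) , rounds-↭ _ (u ∷ v ∷ vs) ,
      rounds-linked _ (AllPairs.map⁻ ac) ,
      (λ ws → head-rounds u (v ∷ vs) ws) ,
      λ { eq → last-two vs eq }
      where
      last-two : ∀ vs → map toList vs ≡ [] → last (rounds _ (u ∷ v ∷ vs)) ≡ last (toList v)
      last-two [] refl = last-rounds u v

-- The inequality 2 d ≤ n.

size-lower-bound : ∀ {k} h → 2 ≤ k → suc (2 * h) ≤ size k h
size-lower-bound zero    2≤k = s≤s z≤n
size-lower-bound {k} (suc h) 2≤k = s≤s (begin
  2 * suc h              ≡⟨ eq h ⟩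
  2 * h + 2              ≤⟨ +-monoˡ-≤ 2 (m≤m+n (2 * h) (2 * h)) ⟩
  (2 * h + 2 * h) + 2    ≡⟨ eq′ (2 * h) ⟩
  2 * suc (2 * h)        ≤⟨ *-mono-≤ 2≤k (size-lower-bound h 2≤k) ⟩
  k * size k h           ∎)
  where
  open ≤-Reasoning
  eq : ∀ h → 2 * suc h ≡ 2 * h + 2
  eq = solve-∀
  eq′ : ∀ a → (a + a) + 2 ≡ 2 * suc a
  eq′ = solve-∀

-- At least three branches with at least 2 m + 1 vertices each, and the centre, give 6 m + 4
-- vertices. The bound is attained by the star with three leaves.
even-diameter-bound : ∀ {k} m → 2 ≤ k → 2 * (suc m + suc m) ≤ suc (suc k * size k m)
even-diameter-bound {k} m 2≤k = begin
  2 * (suc m + suc m)         ≡⟨ eq m ⟩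
  4 + 4 * m                   ≤⟨ +-monoʳ-≤ 4 (*-monoˡ-≤ m {4} {6} (s≤s (s≤s (s≤s (s≤s z≤n))))) ⟩
  4 + 6 * m                   ≡⟨ eq′ m ⟩
  suc (3 * suc (2 * m))       ≤⟨ s≤s (*-mono-≤ (s≤s 2≤k) (size-lower-bound m 2≤k)) ⟩
  suc (suc k * size k m)      ∎
  where
  open ≤-Reasoning
  eq : ∀ m → 2 * (suc m + suc m) ≡ 4 + 4 * m
  eq = solve-∀
  eq′ : ∀ m → 4 + 6 * m ≡ suc (3 * suc (2 * m))
  eq′ = solve-∀

odd-diameter-bound : ∀ {k} m → 2 ≤ k → 2 * suc (m + m) ≤ size k m + size k m
odd-diameter-bound {k} m 2≤k = begin
  2 * suc (m + m)             ≡⟨ eq m ⟩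
  suc (2 * m) + suc (2 * m)   ≤⟨ +-mono-≤ (size-lower-bound m 2≤k) (size-lower-bound m 2≤k) ⟩
  size k m + size k m         ∎
  where
  open ≤-Reasoning
  eq : ∀ m → 2 * suc (m + m) ≡ suc (2 * m) + suc (2 * m)
  eq = solve-∀

-- The hamiltonian chromatic number for each parity of the diameter.

2≤length⇒∷∷ : {A : Set} (xs : List A) → 2 ≤ length xs → ∃[ x ] ∃[ y ] ∃[ zs ] xs ≡ x ∷ y ∷ zs
2≤length⇒∷∷ (x ∷ y ∷ zs) _ = x , y , zs , refl
2≤length⇒∷∷ (x ∷ []) (s≤s ())

Unique-resp-↭ : {A : Set} {xs ys : List A} → xs ↭ ys → Unique xs → Unique ys
Unique-resp-↭ xs↭ys = ↭ₛ.Unique-resp-↭ (setoid _) (↭⇒↭ₛ xs↭ys)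

module HamiltonianNumber {n : ℕ} (T : Graph n) {k d : ℕ} (2≤k : 2 ≤ k) (1≤d : 1 ≤ d)
                         (isT : IsT T (suc k) d) where
  open Graph T
  open IsT isT
  open IsSymmetricTree isSymmetricTree using (isTree)
  open Reduction T
  open Tree isTree
  open Branches T isTree
  open Center T isSymmetricTree 1≤d diameter
  open Colouring T isTree

  even-number : ∀ m → d ≡ suc m + suc m →
    ∃[ h ] IsHamiltonianChromaticNumber T h ×
      h + 2 * (suc k * depthSum k m 1) ≡ (suc k * size k m) * (suc k * size k m) + 1
  even-number m d≡ with center d≡
  -- With a single branch, consecutive vertices could not lie in different branches; the degree k +
  -- 1 of the centre excludes this.
  ... | w , balanced = assemble (2≤length⇒∷∷ (neighbours w)
          (subst (2 ≤_) (sym degree-w) (s≤s (≤-trans (s≤s z≤n) 2≤k))))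
    where
    f : Fin n → ℕ
    f = D w

    radius : ∀ y → D w y ≤ suc m
    radius y with geodesic w y | geodesic-reduced w y
    ... | ε     | _   = z≤n
    ... | a ◅ r | red = s≤s (depth (balanced a) r red)

    degree-w : length (neighbours w) ≡ suc k
    -- A leaf has a vertex at distance d, beyond the radius `suc m` of w.
    degree-w = nonleaf-degree w λ leaf → let y , D≡d = leaf-far leaf in
      contradiction (subst (_≤ suc m) (trans D≡d d≡) (radius y)) (m+1+n≰m (suc m))

    f-branch : ∀ {z x} → Adj w z → (r : Walk T z x) → ReducedFrom w r → f x ≡ 1 + edges T r
    f-branch a r red = D-reduced (a ◅ r) red

    additive : ∀ {u v x y} → Adj w u → Adj w v → u ≢ v →
               x ∈ branch m w u → y ∈ branch m w v → Additive f 0 x y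
    additive a b u≢v x∈ y∈ with ∈-branch⁻ m x∈ | ∈-branch⁻ m y∈
    ... | r , red | s , red′ = begin
      D _ _                              ≡⟨ D-Diverge (a ◅ r) (b ◅ s) (red , u≢v ∘ sym , red′) ⟩
      suc (edges T r) + suc (edges T s)  ≡⟨ cong₂ _+_ (f-branch a r red) (f-branch b s red′) ⟨
      f _ + f _                          ≡⟨ +-identityʳ _ ⟨
      f _ + f _ + 0                      ∎
      where open ≡-Reasoning

    assemble : (∃[ z₀ ] ∃[ z₁ ] ∃[ zs ] neighbours w ≡ z₀ ∷ z₁ ∷ zs) →
      ∃[ h ] IsHamiltonianChromaticNumber T h ×
        h + 2 * (suc k * depthSum k m 1) ≡ (suc k * size k m) * (suc k * size k m) + 1
    assemble (z₀ , z₁ , zs , nbs≡) = conclude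
      (interleave (Additive f 0) (branch m w z₀) (branch m w z₁) (map (branch m w) zs)
        (All.map⁺ (All.tabulate (λ z∈ → length-branch nonleaf-degree m (balanced (adj-w z∈)))))
        (AllPairs.map⁺ (Unique⇒AllPairs (subst Unique nbs≡ (neighbours-unique w))
          (λ u∈ v∈ u≢v x∈ y∈ → additive (adj-w u∈) (adj-w v∈) u≢v x∈ y∈
                             , additive (adj-w v∈) (adj-w u∈) (u≢v ∘ sym) y∈ x∈))))
      where
      nbs : List (Fin n)
      nbs = z₀ ∷ z₁ ∷ zs

      adj-w : ∀ {z} → z ∈ nbs → Adj w z
      adj-w z∈ = ∈-neighbours⁻ (subst (_ ∈_) (sym nbs≡) z∈)

      all : List (Fin n)
      all = concatMap (branch m w) nbs

      length-nbs : length nbs ≡ suc k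
      length-nbs = trans (cong length (sym nbs≡)) degree-w

      conclude : (∃[ order ] order ↭ all × Linked (Additive f 0) order ×
        (∀ ws {x xs} → branch m w z₀ ≡ x ∷ xs → head (order ++ ws) ≡ just x) ×
        (map (branch m w) zs ≡ [] → last order ≡ last (branch m w z₁))) →
        ∃[ h ] IsHamiltonianChromaticNumber T h ×
          h + 2 * (suc k * depthSum k m 1) ≡ (suc k * size k m) * (suc k * size k m) + 1
      conclude (order , order↭ , linked , head≡ , _) =
        let h , number , value = hamiltonian-number f 0 D≤d 2d≤n
               (λ {u} {v} _ → subst (D u v ≤_) (sym (+-identityʳ _)) (D-triangle w u v))
               1≤f+f
               -- The centre is additive with every vertex and can be put last. The ends are then z₀
               -- and w, with f equal to 1 and 0, the least possible for two distinct vertices.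
               (order ++ w ∷ []) uniq complete
               (Linked.++⁺ linked
                 (connected⁺ order (w ∷ []) (λ { last≡ refl → additive-w (last⇒∈ order last≡) })) [-])
               (head≡ (w ∷ []) (proj₂ (branch-root m w z₀))) (last-++-∷ order w)
               (λ { refl → adj-irrefl refl (adj-w (here refl)) })
               (cong₂ _+_ (f-branch (adj-w (here refl)) ε tt) (D-refl w))
        in h , number , (begin
          h + 2 * (suc k * depthSum k m 1)                    ≡⟨ cong (λ x → h + 2 * x) weight-order ⟨
          h + 2 * weight f 0 (order ++ w ∷ [])                ≡⟨ eq h (weight f 0 (order ++ w ∷ [])) (n ∸ 1) ⟩
          h + 2 * weight f 0 (order ++ w ∷ []) + (n ∸ 1) * 0  ≡⟨ value ⟩
          (n ∸ 1) * (n ∸ 1) + 1                               ≡⟨ cong (λ x → (x ∸ 1) * (x ∸ 1) + 1) n≡ ⟩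
          (suc k * size k m) * (suc k * size k m) + 1         ∎)
        where
        open ≡-Reasoning

        eq : ∀ h w N → h + 2 * w ≡ h + 2 * w + N * 0
        eq = solve-∀

        1≤f+f : ∀ {u v} → u ≢ v → 1 ≤ f u + f v
        1≤f+f {u} {v} u≢v with w ≟ u
        ... | yes refl = ≤-trans (D-positive u≢v) (m≤n+m (f v) (f u))
        ... | no  w≢u  = ≤-trans (D-positive w≢u) (m≤m+n (f u) (f v))

        ∈-all⁻ : ∀ {x} → x ∈ order → ∃[ z ] z ∈ nbs × x ∈ branch m w z
        ∈-all⁻ x∈ = find (∈-concatMap⁻ (branch m w) (↭.∈-resp-↭ order↭ x∈))

        additive-w : ∀ {x} → x ∈ order → Additive f 0 x w
        additive-w {x} x∈ = begin
          D x w              ≡⟨ D-sym x w ⟩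
          f x                ≡⟨ +-identityʳ (f x) ⟨
          f x + 0            ≡⟨ cong (f x +_) (D-refl w) ⟨
          f x + f w          ≡⟨ +-identityʳ _ ⟨
          f x + f w + 0      ∎

        uniq : Unique (order ++ w ∷ [])
        uniq = Unique.++⁺
          (Unique-resp-↭ (↭-sym order↭)
            (branches-unique m (branch-unique m) adj-w (subst Unique nbs≡ (neighbours-unique w))))
          ([] ∷ [])
          (λ { (w∈ , here refl) → let z , z∈ , w∈′ = ∈-all⁻ w∈ in root∉branch m (adj-w z∈) w∈′ })

        complete : ∀ x → x ∈ order ++ w ∷ []
        complete x with geodesic w x | geodesic-reduced w x
        ... | ε     | _   = ∈-++⁺ʳ order (here refl)
        ... | a ◅ r | red = ∈-++⁺ˡ (↭.∈-resp-↭ (↭-sym order↭) (∈-concatMap⁺ (branch m w)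
          (Any.map (λ { refl → ∈-branch⁺ m r red (depth (balanced a) r red) })
            (subst (_ ∈_) nbs≡ (∈-neighbours⁺ a)))))

        length-all : length order ≡ suc k * size k m
        length-all = trans (↭.↭-length order↭) (trans
          (concatMap-sum length refl (λ xs ys → length-++ xs {ys}) (branch m w) nbs
            (λ z∈ → length-branch nonleaf-degree m (balanced (adj-w z∈))))
          (cong (_* size k m) length-nbs))

        n≡ : n ≡ suc (suc k * size k m)
        n≡ = trans (sym (↭-allFin⇒length (unique-complete⇒↭ uniq complete)))
          (trans (length-++ order) (trans (+-comm (length order) 1) (cong suc length-all)))

        weight-order : weight f 0 (order ++ w ∷ []) ≡ suc k * depthSum k m 1
        weight-order = begin
          sum (map f (order ++ w ∷ []))      ≡⟨ cong sum (map-++ f order (w ∷ [])) ⟩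
          sum (map f order ++ f w ∷ [])      ≡⟨ sum-++ (map f order) (f w ∷ []) ⟩
          sum (map f order) + (f w + 0)
            ≡⟨ cong₂ _+_ (sum-↭ (↭.map⁺ f order↭)) (trans (+-identityʳ _) (D-refl w)) ⟩
          sum (map f all) + 0
            ≡⟨ +-identityʳ _ ⟩
          sum (map f all)
            ≡⟨ concatMap-sum (sum ∘ map f) refl
                 (λ xs ys → trans (cong sum (map-++ f xs ys)) (sum-++ (map f xs) (map f ys)))
                 (branch m w) nbs
                 (λ z∈ → sum-branch nonleaf-degree f m 1 (balanced (adj-w z∈)) (f-branch (adj-w z∈))) ⟩
          length nbs * depthSum k m 1        ≡⟨ cong (_* depthSum k m 1) length-nbs ⟩
          suc k * depthSum k m 1             ∎

        2d≤n : 2 * d ≤ n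
        2d≤n = subst₂ (λ a b → 2 * a ≤ b) (sym d≡) (sym n≡) (even-diameter-bound m 2≤k)

  odd-number : ∀ m → d ≡ suc (suc m + suc m) →
    ∃[ h ] IsHamiltonianChromaticNumber T h ×
      h + 2 * (2 * depthSum k (suc m) 0) + suc (2 * (k * size k m))
        ≡ suc (2 * (k * size k m)) * suc (2 * (k * size k m))
  odd-number m′ d≡ with central-edge d≡
  ... | w , w′ , balanced , balanced′ with branch-root (suc m′) w w′
  ... | t , branch≡ = conclude
    -- The second side is rotated to put its root w′ last: the ordering runs from w to w′, and f
    -- vanishes at both.
    (interleave (Additive f 1) A (t ++ w′ ∷ []) []
      (length-A ∷ trans (↭.↭-length rotated) length-B ∷ [])
      (((λ x∈ y∈ → additive x∈ y∈) ∷ []) ∷ [] ∷ []))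
    where
    m : ℕ
    m = suc m′

    A B : List (Fin n)
    A = branch m w′ w
    B = branch m w w′

    length-A : length A ≡ size k m
    length-A = length-branch nonleaf-degree m balanced

    length-B : length B ≡ size k m
    length-B = length-branch nonleaf-degree m balanced′

    rotated : t ++ w′ ∷ [] ↭ B
    rotated = ↭-trans (↭.++-comm t (w′ ∷ [])) (↭-reflexive (sym branch≡))

    f : Fin n → ℕ
    f x = D w x ⊓ D w′ x

    f-A : ∀ {x} (r : Walk T w x) → ReducedFrom w′ r → f x ≡ edges T r
    f-A r red = trans
      (cong₂ _⊓_ (D-reduced r (ReducedFrom⇒Reduced r red)) (D-reduced (adj balanced ◅ r) red))
      (m≤n⇒m⊓n≡m (n≤1+n _))

    f-B : ∀ {x} (r : Walk T w′ x) → ReducedFrom w r → f x ≡ edges T r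
    f-B r red = trans
      (cong₂ _⊓_ (D-reduced (adj balanced′ ◅ r) red) (D-reduced r (ReducedFrom⇒Reduced r red)))
      (m≥n⇒m⊓n≡n (n≤1+n _))

    crossing : ∀ {x y} (r : Walk T w x) (s : Walk T w′ y) → ReducedFrom w′ r → ReducedFrom w s →
               Additive f 1 x y
    crossing {x} {y} r s red red′ = begin
      D x y                       ≡⟨ D-sym x y ⟩
      D y x                       ≡⟨ D-Diverge (adj balanced′ ◅ s) r (red′ , red) ⟩
      suc (edges T s) + edges T r ≡⟨ eq (edges T s) (edges T r) ⟩
      edges T r + edges T s + 1   ≡⟨ cong₂ (λ a b → a + b + 1) (f-A r red) (f-B s red′) ⟨
      f x + f y + 1               ∎
      where
      open ≡-Reasoning
      eq : ∀ a b → suc a + b ≡ b + a + 1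
      eq = solve-∀

    additive-sym : ∀ {x y} → Additive f 1 x y → Additive f 1 y x
    additive-sym {x} {y} eq = trans (D-sym y x) (trans eq (cong (_+ 1) (+-comm (f x) (f y))))

    additive : ∀ {x y} → x ∈ A → y ∈ t ++ w′ ∷ [] → Additive f 1 x y × Additive f 1 y x
    additive x∈ y∈ with ∈-branch⁻ m x∈ | ∈-branch⁻ m (↭.∈-resp-↭ rotated y∈)
    ... | r , red | s , red′ = crossing r s red red′ , additive-sym (crossing r s red red′)

    Side : Fin n → Set
    Side x = (∃[ r ] ReducedFrom {w} {x} w′ r) ⊎ (∃[ r ] ReducedFrom {w′} {x} w r)

    side : ∀ x → Side x
    side x with geodesic w x | geodesic-reduced w x
    ... | ε | _ = inj₁ (ε , tt)
    ... | _◅_ {j = z} a r | red with z ≟ w′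
    ...   | yes refl = inj₂ (r , red)
    ...   | no z≢w′  = inj₁ (a ◅ r , z≢w′ , red)

    -- On the same side the detour through the nearer centre even saves the 1; on different sides
    -- the path crosses the central edge and equality holds.
    D≤f+f+1 : ∀ x y → Side x → Side y → D x y ≤ f x + f y + 1
    D≤f+f+1 x y (inj₁ (r , red)) (inj₁ (s , red′)) = begin
      D x y                      ≤⟨ D-triangle w x y ⟩
      D w x + D w y              ≡⟨ cong₂ _+_ (D-reduced r (ReducedFrom⇒Reduced r red))
                                           (D-reduced s (ReducedFrom⇒Reduced s red′)) ⟩
      edges T r + edges T s      ≡⟨ cong₂ _+_ (f-A r red) (f-A s red′) ⟨
      f x + f y                  ≤⟨ m≤m+n _ 1 ⟩
      f x + f y + 1              ∎
      where open ≤-Reasoning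
    D≤f+f+1 x y (inj₁ (r , red)) (inj₂ (s , red′)) = ≤-reflexive (crossing r s red red′)
    D≤f+f+1 x y (inj₂ (r , red)) (inj₁ (s , red′)) = ≤-reflexive (additive-sym (crossing s r red′ red))
    D≤f+f+1 x y (inj₂ (r , red)) (inj₂ (s , red′)) = begin
      D x y                      ≤⟨ D-triangle w′ x y ⟩
      D w′ x + D w′ y            ≡⟨ cong₂ _+_ (D-reduced r (ReducedFrom⇒Reduced r red))
                                           (D-reduced s (ReducedFrom⇒Reduced s red′)) ⟩
      edges T r + edges T s      ≡⟨ cong₂ _+_ (f-B r red) (f-B s red′) ⟨
      f x + f y                  ≤⟨ m≤m+n _ 1 ⟩
      f x + f y + 1              ∎
      where open ≤-Reasoning

    conclude : (∃[ order ] order ↭ A ++ (t ++ w′ ∷ []) ++ [] × Linked (Additive f 1) order ×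
      (∀ ws {x xs} → A ≡ x ∷ xs → head (order ++ ws) ≡ just x) ×
      (_≡_ {A = List (List (Fin n))} [] [] → last order ≡ last (t ++ w′ ∷ []))) →
      ∃[ h ] IsHamiltonianChromaticNumber T h ×
        h + 2 * (2 * depthSum k m 0) + suc (2 * (k * size k m′))
          ≡ suc (2 * (k * size k m′)) * suc (2 * (k * size k m′))
    conclude (order , order↭ , linked , head≡ , last≡) =
      let h , number , value = hamiltonian-number f 1 D≤d 2d≤n
             (λ {u} {v} _ → D≤f+f+1 u v (side u) (side v))
             (λ _ → z≤n)
             order uniq complete linked
             (trans (cong head (sym (++-identityʳ order))) (head≡ [] (proj₂ (branch-root m w′ w))))
             (trans (last≡ refl) (last-++-∷ t w′))
             (λ { refl → adj-irrefl refl (adj balanced) })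
             (cong₂ _+_ (f-A ε tt) (f-B ε tt))
      in h , number , (begin
        h + 2 * (2 * depthSum k m 0) + N
          ≡⟨ cong₂ (λ x y → h + 2 * x + y) weight-order (trans (*-identityʳ (n ∸ 1)) n-1≡) ⟨
        h + 2 * weight f 1 order + (n ∸ 1) * 1    ≡⟨ value ⟩
        (n ∸ 1) * (n ∸ 1) + 0                     ≡⟨ +-identityʳ _ ⟩
        (n ∸ 1) * (n ∸ 1)                         ≡⟨ cong (λ x → x * x) n-1≡ ⟩
        N * N                                     ∎)
      where
      open ≡-Reasoning

      N : ℕ
      N = suc (2 * (k * size k m′))

      order↭A++B : order ↭ A ++ B
      order↭A++B = ↭-trans order↭
        (↭.++⁺ˡ A (↭-trans (↭-reflexive (++-identityʳ (t ++ w′ ∷ []))) rotated))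

      uniq : Unique order
      uniq = Unique-resp-↭ (↭-sym order↭A++B) (Unique.++⁺
        (branch-unique m (adj balanced)) (branch-unique m (adj balanced′)) disjoint)
        where
        disjoint : ∀ {x} → ¬ (x ∈ A × x ∈ B)
        -- A vertex on both sides would be additive with itself, that is 0 = 2 f x + 1.
        disjoint {x} (x∈A , x∈B) with ∈-branch⁻ m x∈A | ∈-branch⁻ m x∈B
        ... | r , red | s , red′ with () ← trans (sym (D-refl x))
          (trans (crossing r s red red′) (+-comm (f x + f x) 1))

      complete : ∀ x → x ∈ order
      complete x = ↭.∈-resp-↭ (↭-sym order↭A++B) (∈-A++B (side x))
        where
        ∈-A++B : Side x → x ∈ A ++ B
        ∈-A++B (inj₁ (r , red)) = ∈-++⁺ˡ (∈-branch⁺ m r red (depth balanced r red))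
        ∈-A++B (inj₂ (r , red)) = ∈-++⁺ʳ A (∈-branch⁺ m r red (depth balanced′ r red))

      n≡ : n ≡ size k m + size k m
      n≡ = begin
        n                        ≡⟨ ↭-allFin⇒length (unique-complete⇒↭ uniq complete) ⟨
        length order             ≡⟨ ↭.↭-length order↭A++B ⟩
        length (A ++ B)          ≡⟨ length-++ A ⟩
        length A + length B      ≡⟨ cong₂ _+_ length-A length-B ⟩
        size k m + size k m      ∎

      n-1≡ : n ∸ 1 ≡ N
      n-1≡ = trans (cong (_∸ 1) n≡) (eq (k * size k m′))
        where
        eq : ∀ a → a + suc a ≡ suc (2 * a)
        eq = solve-∀

      weight-order : weight f 1 order ≡ 2 * depthSum k m 0
      weight-order = begin
        sum (map f order)                 ≡⟨ sum-↭ (↭.map⁺ f order↭A++B) ⟩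
        sum (map f (A ++ B))              ≡⟨ trans (cong sum (map-++ f A B)) (sum-++ (map f A) (map f B)) ⟩
        sum (map f A) + sum (map f B)     ≡⟨ cong₂ _+_ (sum-branch nonleaf-degree f m 0 balanced f-A)
                                                       (sum-branch nonleaf-degree f m 0 balanced′ f-B) ⟩
        S + S                             ≡⟨ cong (S +_) (+-identityʳ S) ⟨
        2 * S                             ∎
        where
        S : ℕ
        S = depthSum k m 0

      2d≤n : 2 * d ≤ n
      2d≤n = subst₂ (λ a b → 2 * a ≤ b) (sym d≡) (sym n≡) (odd-diameter-bound m 2≤k)

-- The two parities combined.

2∤⇒odd : ∀ d → 2 ∤ d → d ≡ suc (d / 2 * 2)
2∤⇒odd d 2∤d with d % 2 in d%2 | m%n<n d 2 | m≡m%n+[m/n]*n d 2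
... | zero        | _            | _  = contradiction (m%n≡0⇒n∣m d 2 d%2) 2∤d
... | suc zero    | _            | eq = eq
... | suc (suc _) | s≤s (s≤s ()) | _

m*2≡m+m : ∀ m → m * 2 ≡ m + m
m*2≡m+m = solve-∀

theorem6 : (k d : ℕ) .{{_ : NonTrivial k}} .{{_ : NonTrivial d}} →
    {n : ℕ} (T : Graph n) → IsT T (suc k) d →
    (2 ∣ d → ∃[ h ] IsHamiltonianChromaticNumber T h × fromℕ h ≡ evenValue k d)
    × (2 ∤ d → ∃[ h ] IsHamiltonianChromaticNumber T h × fromℕ h ≡ oddValue k d)
theorem6 (suc (suc i)) d T isT = even , odd
  where
  open ClosedForms.Values i
  open HamiltonianNumber T {suc (suc i)} {d} (s≤s (s≤s z≤n)) (<⇒≤ (nonTrivial⇒n>1 d)) isT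

  even : 2 ∣ d → ∃[ h ] IsHamiltonianChromaticNumber T h × fromℕ h ≡ evenValue (suc (suc i)) d
  even (divides zero    d≡) = contradiction (subst (2 ≤_) d≡ (nonTrivial⇒n>1 d)) λ ()
  even (divides (suc m) d≡) =
    map₂ (λ {h} → map₂ (λ value →
           subst (λ d → fromℕ h ≡ evenValue (suc (suc i)) d) (sym d≡) (even-value m h value)))
         (even-number m (trans d≡ (m*2≡m+m (suc m))))

  odd : 2 ∤ d → ∃[ h ] IsHamiltonianChromaticNumber T h × fromℕ h ≡ oddValue (suc (suc i)) d
  odd 2∤d = from-half (d / 2) (2∤⇒odd d 2∤d)
    where
    from-half : ∀ m → d ≡ suc (m * 2) →
      ∃[ h ] IsHamiltonianChromaticNumber T h × fromℕ h ≡ oddValue (suc (suc i)) d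
    from-half zero    d≡ = contradiction (subst (2 ≤_) d≡ (nonTrivial⇒n>1 d)) λ { (s≤s ()) }
    from-half (suc m) d≡ =
      map₂ (λ {h} → map₂ (λ value →
             subst (λ d → fromℕ h ≡ oddValue (suc (suc i)) d) (sym d≡) (odd-value m h value)))
           (odd-number m (trans d≡ (cong suc (m*2≡m+m (suc m)))))
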